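{- Let $G\ncong K_n$ be a connected graph on $n$ vertices with chromatic number $\chi$. Then $$m_{D^{L}(G)}\left(n,\,n+\left\lceil\frac{n}{\chi}\right\rceil\right)\leq n-\left\lceil\frac{n}{\chi}\right\rceil-C_{\overline{G}}+1,$$ where $C_{\overline{G}}$ is the number of connected components of the complement $\overline{G}$ of $G$. The bound is best possible for $\chi=2$ (when $n$ is odd) and for $\chi=n-1$: equality holds for the complete bipartite graph $K_{m+1,m}$, where $n=2m+1$, and for the complete multipartite graph $K_{2,1,1,\dots,1}$ with one part of size $2$ and $n-2$ parts of size $1$, respectively.
   Context: All graphs are finite, simple and connected (except that complements may be disconnected). For a connected graph $G$ with vertex set $\{v_1,\dots,v_n\}$, $d_{uv}$ is the length of a shortest path between $u$ and $v$, $D(G)=(d_{uv})$ is the distance matrix, $Tr(v)=\sum_{u\in V(G)}d_{uv}$ is the transmission of $v$, and the distance Laplacian matrix is $D^L(G)=\mathrm{diag}(Tr(v_1),\dots,Tr(v_n))-D(G)$. Its eigenvalues (all real) are the distance Laplacian eigenvalues of $G$. For an interval $I\subseteq\mathbb{R}$, $m_{D^L(G)}I$ denotes the number of distance Laplacian eigenvalues of $G$, counted with multiplicity, lying in $I$. $K_n$ is the complete graph on $n$ vertices. -}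

module Defs where

open import Algebra.Bundles.Raw using (RawMonoid)
import Algebra.Definitions.RawMonoid as RawMonoidDefs
open import Data.Bool using (if_then_else_)
open import Data.Empty using (⊥-elim)
open import Data.Fin using (Fin; zero; suc; splitAt)
import Data.Fin.Properties as Fin
open import Data.Integer as ℤ using (ℤ; +_)
open import Data.List using ([]; _∷_; length)
open import Data.Nat as ℕ using (ℕ; zero; suc; _≤_; z≤n; s≤s; _⊔_)
import Data.Nat.DivMod as ℕ
import Data.Nat.Properties as ℕ
open import Data.Nat.ListAction using (sum)
open import Data.Product using (Σ; ∃; _×_; _,_; proj₁; proj₂)
open import Data.Rational as ℚ using (ℚ; 0ℚ; 1ℚ)
import Data.Rational.Properties as ℚ
import Data.Rational.Solver as ℚ-Solver
open import Data.Sum using ([_,_]′)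
open import Data.Vec.Functional using (Vector)
open import Function using (_∘_; _⇔_; _↔_; const; Inverse)
open import Level using (0ℓ)
open import Relation.Binary using (Decidable)
open import Relation.Binary.PropositionalEquality
  using (_≡_; _≢_; refl; sym; trans; cong; subst; ≢-sym)
open import Relation.Nullary using (¬_; Dec; yes; no; does; ¬?; _×-dec_)
open import Relation.Nullary.Decidable using (map′)
import Relation.Unary as U

-- Reals are Cauchy sequences of rationals, with equality _≈_.  As ε
-- ranges over all positive rationals, "≤ ε" and "< ε" are interchangeable.
record ℝ : Set where
  constructor mkℝ
  field
    seq    : ℕ → ℚ
    cauchy : ∀ ε → 0ℚ ℚ.< ε →
             ∃ λ N → ∀ m n → N ≤ m → N ≤ n → ℚ.∣ seq m ℚ.- seq n ∣ ℚ.≤ ε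

open ℝ public

infix  4 _≈_ _<_
infixl 6 _+_
infixl 7 _*_

_≈_ : ℝ → ℝ → Set
x ≈ y = ∀ ε → 0ℚ ℚ.< ε → ∃ λ N → ∀ n → N ≤ n → ℚ.∣ seq x n ℚ.- seq y n ∣ ℚ.≤ ε

-- The terms must be eventually separated by a fixed positive gap:
-- termwise strict inequality would allow equal limits.
_<_ : ℝ → ℝ → Set
x < y = ∃ λ ε → 0ℚ ℚ.< ε × ∃ λ N → ∀ n → N ≤ n → seq x n ℚ.+ ε ℚ.≤ seq y n

fromℚ : ℚ → ℝ
fromℚ p = mkℝ (const p) λ ε 0<ε → 0 , λ _ _ _ _ →
  subst (ℚ._≤ ε) (sym (cong ℚ.∣_∣ (ℚ.+-inverseʳ p))) (ℚ.<⇒≤ 0<ε)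

fromℤ : ℤ → ℝ
fromℤ i = fromℚ (i ℚ./ 1)

fromℕ : ℕ → ℝ
fromℕ n = fromℤ (+ n)

0ℝ : ℝ
0ℝ = fromℕ 0

private
  open ℚ-Solver.+-*-Solver using (solve; _:+_; _:*_; _:-_; _:=_)

  regroup-+ : ∀ a b c d → (a ℚ.+ b) ℚ.- (c ℚ.+ d) ≡ (a ℚ.- c) ℚ.+ (b ℚ.- d)
  regroup-+ = solve 4 (λ a b c d → (a :+ b) :- (c :+ d) := (a :- c) :+ (b :- d)) refl

  regroup-* : ∀ a b c d → a ℚ.* b ℚ.- c ℚ.* d ≡ a ℚ.* (b ℚ.- d) ℚ.+ d ℚ.* (a ℚ.- c)
  regroup-* = solve 4 (λ a b c d → a :* b :- c :* d := a :* (b :- d) :+ d :* (a :- c)) refl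

  split-off : ∀ a c → a ≡ c ℚ.+ (a ℚ.- c)
  split-off = solve 2 (λ a c → a := c :+ (a :- c)) refl

  divide : ∀ B ε → 0ℚ ℚ.< B → 0ℚ ℚ.< ε → ∃ λ δ → 0ℚ ℚ.< δ × B ℚ.* δ ≡ ε
  divide B ε 0<B 0<ε = ℚ.1/ B ℚ.* ε
    , subst (ℚ._< ℚ.1/ B ℚ.* ε) (ℚ.*-zeroʳ (ℚ.1/ B)) (ℚ.*-monoʳ-<-pos (ℚ.1/ B) 0<ε)
    , trans (sym (ℚ.*-assoc B (ℚ.1/ B) ε))
        (trans (cong (ℚ._* ε) (ℚ.*-inverseʳ B)) (ℚ.*-identityˡ ε))
    where instance
      B-pos : ℚ.Positive B
      B-pos = ℚ.positive 0<B
      B-nonZero : ℚ.NonZero B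
      B-nonZero = ℚ.pos⇒nonZero B
      1/B-pos : ℚ.Positive (ℚ.1/ B)
      1/B-pos = ℚ.1/pos⇒pos B

  halve : ∀ ε → 0ℚ ℚ.< ε → ∃ λ δ → 0ℚ ℚ.< δ × δ ℚ.+ δ ≡ ε
  halve ε 0<ε with divide (1ℚ ℚ.+ 1ℚ) ε (ℚ.positive⁻¹ (1ℚ ℚ.+ 1ℚ)) 0<ε
  ... | δ , 0<δ , eq = δ , 0<δ , trans (sym double) eq
    where
    double : (1ℚ ℚ.+ 1ℚ) ℚ.* δ ≡ δ ℚ.+ δ
    double = trans (ℚ.*-distribʳ-+ δ 1ℚ 1ℚ) (cong (λ x → x ℚ.+ x) (ℚ.*-identityˡ δ))

  +-close : ∀ a b c d {δ} → ℚ.∣ a ℚ.- c ∣ ℚ.≤ δ → ℚ.∣ b ℚ.- d ∣ ℚ.≤ δ →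
            ℚ.∣ (a ℚ.+ b) ℚ.- (c ℚ.+ d) ∣ ℚ.≤ δ ℚ.+ δ
  +-close a b c d {δ} ac bd = begin
    ℚ.∣ (a ℚ.+ b) ℚ.- (c ℚ.+ d) ∣       ≡⟨ cong ℚ.∣_∣ (regroup-+ a b c d) ⟩
    ℚ.∣ (a ℚ.- c) ℚ.+ (b ℚ.- d) ∣       ≤⟨ ℚ.∣p+q∣≤∣p∣+∣q∣ (a ℚ.- c) (b ℚ.- d) ⟩
    ℚ.∣ a ℚ.- c ∣ ℚ.+ ℚ.∣ b ℚ.- d ∣     ≤⟨ ℚ.+-mono-≤ ac bd ⟩
    δ ℚ.+ δ                           ∎
    where open ℚ.≤-Reasoning

  ∣p*q∣-≤ : ∀ p q {B δ} → ℚ.∣ p ∣ ℚ.≤ B → ℚ.∣ q ∣ ℚ.≤ δ → ℚ.∣ p ℚ.* q ∣ ℚ.≤ B ℚ.* δ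
  ∣p*q∣-≤ p q {B} {δ} p≤B q≤δ = begin
    ℚ.∣ p ℚ.* q ∣        ≡⟨ ℚ.∣p*q∣≡∣p∣*∣q∣ p q ⟩
    ℚ.∣ p ∣ ℚ.* ℚ.∣ q ∣  ≤⟨ ℚ.*-monoʳ-≤-nonNeg ℚ.∣ q ∣ {{ℚ.∣-∣-nonNeg q}} p≤B ⟩
    B ℚ.* ℚ.∣ q ∣        ≤⟨ ℚ.*-monoˡ-≤-nonNeg B {{ℚ.nonNegative (ℚ.≤-trans (ℚ.0≤∣p∣ p) p≤B)}} q≤δ ⟩
    B ℚ.* δ             ∎
    where open ℚ.≤-Reasoning

  *-close : ∀ a b c d {B B′ δ} → ℚ.∣ a ∣ ℚ.≤ B → ℚ.∣ d ∣ ℚ.≤ B′ →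
            ℚ.∣ a ℚ.- c ∣ ℚ.≤ δ → ℚ.∣ b ℚ.- d ∣ ℚ.≤ δ →
            ℚ.∣ a ℚ.* b ℚ.- c ℚ.* d ∣ ℚ.≤ (B ℚ.+ B′) ℚ.* δ
  *-close a b c d {B} {B′} {δ} a≤B d≤B′ ac bd = begin
    ℚ.∣ a ℚ.* b ℚ.- c ℚ.* d ∣
      ≡⟨ cong ℚ.∣_∣ (regroup-* a b c d) ⟩
    ℚ.∣ a ℚ.* (b ℚ.- d) ℚ.+ d ℚ.* (a ℚ.- c) ∣
      ≤⟨ ℚ.∣p+q∣≤∣p∣+∣q∣ (a ℚ.* (b ℚ.- d)) (d ℚ.* (a ℚ.- c)) ⟩
    ℚ.∣ a ℚ.* (b ℚ.- d) ∣ ℚ.+ ℚ.∣ d ℚ.* (a ℚ.- c) ∣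
      ≤⟨ ℚ.+-mono-≤ (∣p*q∣-≤ a (b ℚ.- d) a≤B bd) (∣p*q∣-≤ d (a ℚ.- c) d≤B′ ac) ⟩
    B ℚ.* δ ℚ.+ B′ ℚ.* δ
      ≡⟨ ℚ.*-distribʳ-+ δ B B′ ⟨
    (B ℚ.+ B′) ℚ.* δ ∎
    where open ℚ.≤-Reasoning

  EventuallyBounded : (ℕ → ℚ) → Set
  EventuallyBounded s = ∃ λ B → 0ℚ ℚ.< B × ∃ λ N → ∀ n → N ≤ n → ℚ.∣ s n ∣ ℚ.≤ B

  CloseFrom : (ℕ → ℚ) → ℚ → ℕ → Set
  CloseFrom s ε N = ∀ m n → N ≤ m → N ≤ n → ℚ.∣ s m ℚ.- s n ∣ ℚ.≤ ε

  eventuallyBounded : ∀ s → ∃ (CloseFrom s 1ℚ) → EventuallyBounded s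
  eventuallyBounded s (N , close) = ℚ.∣ s N ∣ ℚ.+ 1ℚ
    , ℚ.+-mono-≤-< (ℚ.0≤∣p∣ (s N)) (ℚ.positive⁻¹ 1ℚ)
    , N , λ n N≤n → begin
        ℚ.∣ s n ∣                          ≡⟨ cong ℚ.∣_∣ (split-off (s n) (s N)) ⟩
        ℚ.∣ s N ℚ.+ (s n ℚ.- s N) ∣        ≤⟨ ℚ.∣p+q∣≤∣p∣+∣q∣ (s N) (s n ℚ.- s N) ⟩
        ℚ.∣ s N ∣ ℚ.+ ℚ.∣ s n ℚ.- s N ∣    ≤⟨ ℚ.+-monoʳ-≤ ℚ.∣ s N ∣ (close n N N≤n ℕ.≤-refl) ⟩
        ℚ.∣ s N ∣ ℚ.+ 1ℚ                  ∎
    where open ℚ.≤-Reasoning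

  +-closeFrom : ∀ s t {δ} → ∃ (CloseFrom s δ) → ∃ (CloseFrom t δ) →
                ∃ (CloseFrom (λ n → s n ℚ.+ t n) (δ ℚ.+ δ))
  +-closeFrom s t (M , hs) (N , ht) = M ⊔ N , λ m n hm hn →
    +-close (s m) (t m) (s n) (t n)
      (hs m n (ℕ.m⊔n≤o⇒m≤o M N hm) (ℕ.m⊔n≤o⇒m≤o M N hn))
      (ht m n (ℕ.m⊔n≤o⇒n≤o M N hm) (ℕ.m⊔n≤o⇒n≤o M N hn))

  *-closeFrom : ∀ s t ε → EventuallyBounded s → EventuallyBounded t → 0ℚ ℚ.< ε →
                (∀ δ → 0ℚ ℚ.< δ → ∃ (CloseFrom s δ)) →
                (∀ δ → 0ℚ ℚ.< δ → ∃ (CloseFrom t δ)) →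
                ∃ (CloseFrom (λ n → s n ℚ.* t n) ε)
  *-closeFrom s t ε (B , 0<B , P , bs) (B′ , 0<B′ , Q , bt) 0<ε cs ct =
    combine (divide (B ℚ.+ B′) ε (ℚ.+-mono-< 0<B 0<B′) 0<ε)
    where
    combine₂ : ∀ {δ} → (B ℚ.+ B′) ℚ.* δ ≡ ε → ∃ (CloseFrom s δ) → ∃ (CloseFrom t δ) →
               ∃ (CloseFrom (λ n → s n ℚ.* t n) ε)
    combine₂ eq (M , hs) (N , ht) = (P ⊔ Q) ⊔ (M ⊔ N) , λ m n hm hn →
      let hm′ = ℕ.m⊔n≤o⇒n≤o (P ⊔ Q) (M ⊔ N) hm
          hn′ = ℕ.m⊔n≤o⇒n≤o (P ⊔ Q) (M ⊔ N) hn
      in subst (ℚ.∣ s m ℚ.* t m ℚ.- s n ℚ.* t n ∣ ℚ.≤_) eq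
           (*-close (s m) (t m) (s n) (t n)
             (bs m (ℕ.m⊔n≤o⇒m≤o P Q (ℕ.m⊔n≤o⇒m≤o (P ⊔ Q) (M ⊔ N) hm)))
             (bt n (ℕ.m⊔n≤o⇒n≤o P Q (ℕ.m⊔n≤o⇒m≤o (P ⊔ Q) (M ⊔ N) hn)))
             (hs m n (ℕ.m⊔n≤o⇒m≤o M N hm′) (ℕ.m⊔n≤o⇒m≤o M N hn′))
             (ht m n (ℕ.m⊔n≤o⇒n≤o M N hm′) (ℕ.m⊔n≤o⇒n≤o M N hn′)))

    combine : ∃ (λ δ → 0ℚ ℚ.< δ × (B ℚ.+ B′) ℚ.* δ ≡ ε) →
              ∃ (CloseFrom (λ n → s n ℚ.* t n) ε)
    combine (δ , 0<δ , eq) = combine₂ eq (cs δ 0<δ) (ct δ 0<δ)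

_+_ : ℝ → ℝ → ℝ
x + y = mkℝ (λ n → seq x n ℚ.+ seq y n) λ ε 0<ε →
  let δ , 0<δ , δ+δ≡ε = halve ε 0<ε
  in subst (λ e → ∃ (CloseFrom (λ n → seq x n ℚ.+ seq y n) e)) δ+δ≡ε
       (+-closeFrom (seq x) (seq y) (cauchy x δ 0<δ) (cauchy y δ 0<δ))

_*_ : ℝ → ℝ → ℝ
x * y = mkℝ (λ n → seq x n ℚ.* seq y n) λ ε 0<ε →
  *-closeFrom (seq x) (seq y) ε
    (eventuallyBounded (seq x) (cauchy x 1ℚ (ℚ.positive⁻¹ 1ℚ)))
    (eventuallyBounded (seq y) (cauchy y 1ℚ (ℚ.positive⁻¹ 1ℚ)))
    0<ε (cauchy x) (cauchy y)

+-0-rawMonoid : RawMonoid 0ℓ 0ℓ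
+-0-rawMonoid = record { Carrier = ℝ ; _≈_ = _≈_ ; _∙_ = _+_ ; ε = 0ℝ }

open RawMonoidDefs +-0-rawMonoid public using () renaming (sum to ∑)
open RawMonoidDefs ℕ.+-0-rawMonoid public using () renaming (sum to ∑ᴺ)

Matrix : ℕ → Set
Matrix n = Fin n → Fin n → ℝ

InEigenspace : ∀ {n} → Matrix n → ℝ → Vector ℝ n → Set
InEigenspace A μ v = ∀ i → ∑ (λ j → A i j * v j) ≈ μ * v i

LinearlyIndependent : ∀ {n k} → Vector (Vector ℝ n) k → Set
LinearlyIndependent {_} {k} v =
  ∀ (c : Vector ℝ k) → (∀ i → ∑ (λ j → c j * v j i) ≈ 0ℝ) → ∀ j → c j ≈ 0ℝ

MultiplicityAtLeast : ∀ {n} → Matrix n → ℝ → ℕ → Set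
MultiplicityAtLeast {n} A μ k =
  Σ (Vector (Vector ℝ n) k) λ v → (∀ j → InEigenspace A μ (v j)) × LinearlyIndependent v

⟦_,_⟧ᵒ : ℝ → ℝ → ℝ → Set
⟦ a , b ⟧ᵒ x = a < x × x < b

-- The number of eigenvalues of A in I, counted with multiplicity, is
-- the sum of the multiplicities of the distinct eigenvalues in I.  The
-- matrices considered are symmetric, so the multiplicity of an
-- eigenvalue is the dimension of its eigenspace.  "This number is ≥ k"
-- means that finitely many distinct points of I already contribute k.
EigenvaluesInAtLeast : ∀ {n} → Matrix n → (ℝ → Set) → ℕ → Set
EigenvaluesInAtLeast A I k =
  ∃ λ r → Σ (Vector ℝ r) λ value → Σ (Vector ℕ r) λ mult →
    (∀ i j → i ≢ j → ¬ (value i ≈ value j)) ×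
    (∀ i → I (value i)) ×
    (∀ i → MultiplicityAtLeast A (value i) (mult i)) ×
    ∑ᴺ mult ≡ k

EigenvaluesInExactly : ∀ {n} → Matrix n → (ℝ → Set) → ℕ → Set
EigenvaluesInExactly A I k =
  EigenvaluesInAtLeast A I k × (∀ j → EigenvaluesInAtLeast A I j → j ≤ k)

record Graph (n : ℕ) : Set₁ where
  field
    Adj     : Fin n → Fin n → Set
    adj?    : Decidable Adj
    symm    : ∀ {u v} → Adj u v → Adj v u
    irrefl  : ∀ {u} → ¬ Adj u u

open Graph public

infix 4 _≅_

_≅_ : ∀ {m n} → Graph m → Graph n → Set
_≅_ {m} {n} G H = Σ (Fin m ↔ Fin n) λ f →
  ∀ u v → Adj G u v ⇔ Adj H (Inverse.to f u) (Inverse.to f v)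

K : ∀ n → Graph n
K n = record
  { Adj = _≢_ ; adj? = λ u v → ¬? (u Fin.≟ v) ; symm = ≢-sym ; irrefl = λ p → p refl }

complement : ∀ {n} → Graph n → Graph n
complement G = record
  { Adj    = λ u v → u ≢ v × ¬ Adj G u v
  ; adj?   = λ u v → ¬? (u Fin.≟ v) ×-dec ¬? (adj? G u v)
  ; symm   = λ (p , q) → ≢-sym p , q ∘ symm G
  ; irrefl = λ (p , _) → p refl
  }

-- K⟨ s₁ ∷ … ∷ sᵣ ∷ [] ⟩ is the complete r-partite graph whose parts are
-- consecutive blocks of s₁, …, sᵣ vertices.
partOf : ∀ sizes → Fin (sum sizes) → Fin (length sizes)
partOf (s ∷ ss) u = [ const zero , suc ∘ partOf ss ]′ (splitAt s u)

K⟨_⟩ : ∀ sizes → Graph (sum sizes)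
K⟨ sizes ⟩ = record
  { Adj    = λ u v → partOf sizes u ≢ partOf sizes v
  ; adj?   = λ u v → ¬? (partOf sizes u Fin.≟ partOf sizes v)
  ; symm   = ≢-sym
  ; irrefl = λ p → p refl
  }

Colorable : ∀ {n} → Graph n → ℕ → Set
Colorable {n} G k = Σ (Fin n → Fin k) λ c → ∀ u v → Adj G u v → c u ≢ c v

IsChromaticNumber : ∀ {n} → Graph n → ℕ → Set
IsChromaticNumber G χ = Colorable G χ × (∀ k → Colorable G k → χ ≤ k)

-- The index is the length.  A shortest walk is automatically a path.
data Walk {n} (G : Graph n) : Fin n → Fin n → ℕ → Set where
  []  : ∀ {u} → Walk G u u 0
  _∷_ : ∀ {u v w k} → Adj G u v → Walk G v w k → Walk G u w (suc k)

Joined : ∀ {n} → Graph n → Fin n → Fin n → Set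
Joined G u v = ∃ (Walk G u v)

Connected : ∀ {n} → Graph n → Set
Connected G = ∀ u v → Joined G u v

-- The fibres of a surjection onto Fin c are exactly the components.
ComponentCount : ∀ {n} → Graph n → ℕ → Set
ComponentCount {n} G c = Σ (Fin n → Fin c) λ comp →
  (∀ i → ∃ λ u → comp u ≡ i) × (∀ u v → comp u ≡ comp v ⇔ Joined G u v)

walk? : ∀ {n} (G : Graph n) k u v → Dec (Walk G u v k)
walk? G zero    u w = map′ (λ { refl → [] }) (λ { [] → refl }) (u Fin.≟ w)
walk? G (suc k) u w =
  map′ (λ { (_ , a , p) → a ∷ p }) (λ { (a ∷ p) → _ , a , p })
       (Fin.any? λ v → adj? G u v ×-dec walk? G k v w)

Least : (ℕ → Set) → ℕ → Set
Least P d = P d × (∀ k → P k → d ≤ k)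

least : ∀ {P} → U.Decidable P → ∀ k → P k → ∃ (Least P)
least P? zero p = 0 , p , λ _ _ → z≤n
least {P} P? (suc k) p with P? 0
... | yes p₀ = 0 , p₀ , λ _ _ → z≤n
... | no ¬p₀ with least (P? ∘ suc) k p
...   | d , pd , minimal = suc d , pd , λ where
        zero    p₀ → ⊥-elim (¬p₀ p₀)
        (suc j) pj → s≤s (minimal j pj)

distance : ∀ {n} (G : Graph n) → Connected G → ∀ u v → ∃ (Least (Walk G u v))
distance G conn u v = let k , w = conn u v in least (λ j → walk? G j u v) k w

module _ {n} (G : Graph n) (conn : Connected G) where

  dist : Fin n → Fin n → ℕ
  dist u v = proj₁ (distance G conn u v)

  transmission : Fin n → ℕ
  transmission v = ∑ᴺ (λ u → dist u v)

  distanceLaplacian : Matrix n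
  distanceLaplacian u v =
    fromℤ ((if does (u Fin.≟ v) then + transmission u else + 0) ℤ.- + dist u v)

-- The value at denominator 0 is never used: a graph with chromatic
-- number 0 has no vertices, hence is complete.
⌈_/_⌉ : ℕ → ℕ → ℕ
⌈ n / zero  ⌉ = 0
⌈ n / suc k ⌉ = (n ℕ.+ k) ℕ./ suc k

window : ℕ → ℕ → ℝ → Set
window n χ = ⟦ fromℕ n , fromℕ (n ℕ.+ ⌈ n / χ ⌉) ⟧ᵒ

-- Formed in ℤ, so no subtraction is truncated.
bound : ℕ → ℕ → ℕ → ℤ
bound n χ C = + n ℤ.- + ⌈ n / χ ⌉ ℤ.- + C ℤ.+ + 1

AttainsBound : ∀ {n} → Graph n → ℕ → Set
AttainsBound {n} G χ =
  ¬ (G ≅ K n) × IsChromaticNumber G χ ×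
  Σ (Connected G) λ conn → ∃ λ C → ∃ λ k →
    ComponentCount (complement G) C ×
    EigenvaluesInExactly (distanceLaplacian G conn) (window n χ) k ×
    + k ≡ bound n χ C

{-# OPTIONS --safe #-}
module Submission where

-- For the upper bound, let S be a colour class with p ≥ ⌈n/χ⌉ vertices.  If
-- the window held too many eigenvalues, then some nontrivial combination x of
-- their eigenvectors and of the indicators of the components of the complement
-- would vanish off S and have entries summing to zero: these are n − p + 1
-- linear conditions.  Distances are at least 1, and at least 2 inside S, so
-- ⟨x, Dᴸx⟩ ≥ (n + p)⟨x, x⟩.  But x is also a sum of orthogonal eigenvectors
-- whose eigenvalues are below n + p, since the component indicators contribute
-- an eigenvector for n.  Hence x = 0.
--
-- Nothing about the reals is decided on the way: equality with 0 is stable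
-- under double negation, and that suffices because the goal is an inequality
-- between integers.

open import Algebra.Bundles using (CommutativeRing)
import Algebra.Properties.CommutativeMonoid.Sum
import Algebra.Properties.Group
import Algebra.Properties.Ring
import Algebra.Properties.Semiring.Sum
import Algebra.Solver.Ring
open import Algebra.Solver.Ring.AlmostCommutativeRing
  using (AlmostCommutativeRing; fromCommutativeRing; _-Raw-AlmostCommutative⟶_)
open import Data.Bool using (true; false; if_then_else_)
open import Data.Empty using (⊥; ⊥-elim)
open import Data.Fin using (Fin; zero; suc; punchIn; splitAt; _↑ˡ_; _↑ʳ_)
import Data.Fin.Properties as Fin
open import Data.Integer as ℤ using (ℤ; +_)
import Data.Integer.Properties as ℤ
import Data.Integer.Solver
open import Data.List using (List; []; _∷_; length; map; filter; tabulate; allFin; replicate)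
open import Data.List.Membership.Propositional.Properties using (∈-filter⁺; ∈-allFin)
open import Data.List.Properties using (length-map; length-replicate)
open import Data.List.Relation.Unary.All as All using (All; []; _∷_)
import Data.List.Relation.Unary.All.Properties as All
open import Data.Maybe using (Maybe; just; nothing)
open import Data.Nat as ℕ using (ℕ; zero; suc; s≤s; z≤n)
import Data.Nat.DivMod as ℕ
import Data.Nat.Properties as ℕ
open import Data.Nat.Tactic.RingSolver using (solve-∀)
open import Data.Product using (∃; _×_; _,_; proj₁; proj₂)
open import Data.Rational as ℚ using (ℚ; 0ℚ; 1ℚ; ½)
import Data.Rational.Properties as ℚ
open import Data.Rational.Solver using (module +-*-Solver)
open import Data.Rational.Unnormalised as ℚᵘ using (mkℚᵘ)
import Data.Rational.Unnormalised.Properties as ℚᵘ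
open import Data.Sum as Sum using (_⊎_; inj₁; inj₂; [_,_]′)
open import Data.Vec.Functional as Vec using (Vector; insertAt; _++_)
open import Data.Vec.Functional.Properties
  using (insertAt-lookup; insertAt-punchIn; lookup-++ˡ; lookup-++ʳ)
open import Function using (_∘_; const; Equivalence; Injection; mk⇔)
open import Function.Construct.Identity using (↔-id)
open import Function.Properties.Inverse using (↔⇒↣)
open import Level using (0ℓ)
open import Relation.Binary.PropositionalEquality as ≡ using (_≡_; _≢_)
import Relation.Binary.Reasoning.Setoid
open import Relation.Nullary using (¬_; Dec; yes; no; does; ¬?; contradiction)
open import Relation.Nullary.Decidable using (decidable-stable; dec-true; dec-false)
open import Relation.Unary using (Decidable)

import Defs
open import Defs using
  ( ℝ; mkℝ; seq; cauchy; Matrix; InEigenspace; LinearlyIndependent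
  ; EigenvaluesInAtLeast; ∑; ∑ᴺ
  ; Graph; Adj; adj?; symm; _≅_; K; K⟨_⟩; partOf; complement
  ; IsChromaticNumber; Walk; []; _∷_; Joined; Connected; ComponentCount
  ; dist; distance; transmission; distanceLaplacian
  ; ⌈_/_⌉; window; bound; AttainsBound )

-- Linear algebra over an ordered domain

-- One computation drives the estimate. Let `s` be the indicator of S and compare the distances with
-- the weights 1 + s(u)s(v): 2 inside S and 1 elsewhere. Their Laplacian is explicit, and on vectors
-- that have sum zero and vanish off S it is multiplication by n + p; off the diagonal the distances
-- dominate these weights, which gives the quadratic bound. The case s = 0 explains the eigenvalue
-- n: vertices in different components of the complement are adjacent in G, so a combination of
-- component indicators meets only weights equal to 1 wherever it varies. The condition on the sum
-- of the entries thus serves twice, for the quadratic bound and for turning the indicator part into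
-- an n-eigenvector. With `s` the indicator of the smaller side of K_{m+1,m}, the computation also
-- yields the eigenvectors for equality there. The count compares C + k coefficients with n - p + 1
-- equations, where p is the true size of S and may exceed ⌈n/χ⌉.

record OrderedDomain : Set₁ where
  field
    commutativeRing : CommutativeRing 0ℓ 0ℓ

  open CommutativeRing commutativeRing public

  field
    -- Part of the data, although a ring determines it up to `≈`: for the reals it is `fromℤ`, so
    -- matrix entries agree definitionally with those of `distanceLaplacian`. It also supplies the
    -- solver's coefficients.
    ι         : ℤ → Carrier
    ι-+       : ∀ i j → ι (i ℤ.+ j) ≈ ι i + ι j
    ι-*       : ∀ i j → ι (i ℤ.* j) ≈ ι i * ι j
    ι-neg     : ∀ i → ι (ℤ.- i) ≈ - ι i
    ι-0       : ι (+ 0) ≈ 0#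
    ι-1       : ι (+ 1) ≈ 1#
    1≉0       : ¬ 1# ≈ 0#
    -- This field and `cancelˡ` stand in for a zero test and for division.
    ≈0-stable : ∀ {x} → ¬ ¬ x ≈ 0# → x ≈ 0#
    cancelˡ   : ∀ {x y} → x * y ≈ 0# → ¬ x ≈ 0# → y ≈ 0#
    Nonneg         : Carrier → Set
    Nonneg-resp    : ∀ {x y} → x ≈ y → Nonneg x → Nonneg y
    Nonneg-+       : ∀ {x y} → Nonneg x → Nonneg y → Nonneg (x + y)
    Nonneg-*       : ∀ {x y} → Nonneg x → Nonneg y → Nonneg (x * y)
    Nonneg-square  : ∀ x → Nonneg (x * x)
    Nonneg-antisym : ∀ {x} → Nonneg x → Nonneg (- x) → x ≈ 0#

module OrderedDomainSolver (O : OrderedDomain) where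

  private
    open module O = OrderedDomain O using (commutativeRing)

    almost : AlmostCommutativeRing 0ℓ 0ℓ
    almost = fromCommutativeRing commutativeRing

    integers : AlmostCommutativeRing.rawRing (fromCommutativeRing ℤ.+-*-commutativeRing)
               -Raw-AlmostCommutative⟶ almost
    integers = record
      { ⟦_⟧ = O.ι ; +-homo = O.ι-+ ; *-homo = O.ι-* ; -‿homo = O.ι-neg
      ; 0-homo = O.ι-0 ; 1-homo = O.ι-1 }

    ι-≟ : ∀ i j → Maybe (O.ι i O.≈ O.ι j)
    ι-≟ i j with i ℤ.≟ j
    ... | yes i≡j = just (O.reflexive (≡.cong O.ι i≡j))
    ... | no  _   = nothing

  open Algebra.Solver.Ring _ almost integers ι-≟ public

module Spectral (O : OrderedDomain) where

  open OrderedDomain O hiding (zero)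
  open OrderedDomainSolver O using (solve; _:+_; _:*_; _:-_; :-_; _:=_; con)
  open Algebra.Properties.Ring ring using (-‿+-comm; -0#≈0#)
  open Algebra.Properties.Semiring.Sum semiring
  open Relation.Binary.Reasoning.Setoid setoid

  square≈0 : ∀ {x} → x * x ≈ 0# → x ≈ 0#
  square≈0 x²≈0 = ≈0-stable λ x≉0 → x≉0 (cancelˡ x²≈0 x≉0)

  Nonneg-0 : Nonneg 0#
  Nonneg-0 = Nonneg-resp (zeroˡ 0#) (Nonneg-square 0#)

  Nonneg+Nonneg≈0 : ∀ {x y} → Nonneg x → Nonneg y → x + y ≈ 0# → x ≈ 0#
  Nonneg+Nonneg≈0 {x} {y} 0≤x 0≤y x+y≈0 =
    Nonneg-antisym 0≤x (Nonneg-resp y≈-x 0≤y)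
    where
    y≈-x : y ≈ - x
    y≈-x = begin
      y             ≈⟨ solve 2 (λ x y → y := (x :+ y) :- x) refl x y ⟩
      x + y - x     ≈⟨ +-congʳ x+y≈0 ⟩
      0# - x        ≈⟨ +-identityˡ (- x) ⟩
      - x           ∎

  -- The order excludes characteristic two: 1 is a square, so 1 + 1 ≈ 0 would force 1 ≈ 0. This
  -- undoes the doublings that replace a factor one half in the energy arguments.
  double≈0 : ∀ {x} → x + x ≈ 0# → x ≈ 0#
  double≈0 {x} x+x≈0 = cancelˡ (trans (solve 1 (λ x → (con (+ 1) :+ con (+ 1)) :* x := x :+ x) refl x) x+x≈0)
    λ 2≈0 → 1≉0 (trans (sym ι-1) (Nonneg+Nonneg≈0 0≤1 0≤1 2≈0))
    where
    0≤1 : Nonneg (ι (+ 1))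
    0≤1 = Nonneg-resp (trans (*-identityˡ 1#) (sym ι-1)) (Nonneg-square 1#)

  sum-zero : ∀ {n} {f : Vector Carrier n} → (∀ i → f i ≈ 0#) → sum f ≈ 0#
  sum-zero {n} f≈0 = trans (sum-cong-≋ f≈0) (sum-replicate-zero n)

  sum-neg : ∀ {n} (f : Vector Carrier n) → sum (λ i → - f i) ≈ - sum f
  sum-neg {zero}  f = sym -0#≈0#
  sum-neg {suc n} f = trans (+-congˡ (sum-neg (f ∘ suc))) (-‿+-comm _ _)

  sum-minus : ∀ {n} (f g : Vector Carrier n) →
              sum (λ i → f i - g i) ≈ sum f - sum g
  sum-minus f g = trans (∑-distrib-+ f (λ i → - g i)) (+-congˡ (sum-neg g))

  sum-single : ∀ {n} (f : Vector Carrier n) i → (∀ j → j ≢ i → f j ≈ 0#) → sum f ≈ f i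
  sum-single {suc n} f i f≈0 = begin
    sum f                            ≈⟨ sum-remove f ⟩
    f i + sum (λ j → f (punchIn i j)) ≈⟨ +-congˡ (sum-zero λ j → f≈0 _ (Fin.punchInᵢ≢i i j)) ⟩
    f i + 0#                         ≈⟨ +-identityʳ (f i) ⟩
    f i                              ∎

  sum-↑ : ∀ m {n} (f : Vector Carrier (m ℕ.+ n)) →
          sum f ≈ sum (λ i → f (i ↑ˡ n)) + sum (λ j → f (m ↑ʳ j))
  sum-↑ zero    f = sym (+-identityˡ _)
  sum-↑ (suc m) f = trans (+-congˡ (sum-↑ m (f ∘ suc))) (sym (+-assoc _ _ _))

  Nonneg-sum : ∀ {n} {f : Vector Carrier n} → (∀ i → Nonneg (f i)) → Nonneg (sum f)
  Nonneg-sum {zero}  0≤f = Nonneg-0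
  Nonneg-sum {suc n} 0≤f = Nonneg-+ (0≤f zero) (Nonneg-sum (0≤f ∘ suc))

  Nonneg-sum≈0 : ∀ {n} {f : Vector Carrier n} → (∀ i → Nonneg (f i)) →
                 sum f ≈ 0# → ∀ i → f i ≈ 0#
  Nonneg-sum≈0 {suc n} {f} 0≤f ∑f≈0 i =
    Nonneg+Nonneg≈0 (0≤f i) (Nonneg-sum λ j → 0≤f (punchIn i j))
      (trans (sym (sum-remove f)) ∑f≈0)

  infix 7 _∙_

  _∙_ : ∀ {n} → Vector Carrier n → Vector Carrier n → Carrier
  x ∙ y = sum λ i → x i * y i

  ∙-cong : ∀ {n} {x x′ y y′ : Vector Carrier n} →
           (∀ i → x i ≈ x′ i) → (∀ i → y i ≈ y′ i) → x ∙ y ≈ x′ ∙ y′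
  ∙-cong x≈x′ y≈y′ = sum-cong-≋ λ i → *-cong (x≈x′ i) (y≈y′ i)

  ∙-scaleʳ : ∀ {n} (x y : Vector Carrier n) a → x ∙ (λ i → a * y i) ≈ a * (x ∙ y)
  ∙-scaleʳ x y a = trans
    (sum-cong-≋ λ i → solve 3 (λ a x y → x :* (a :* y) := a :* (x :* y)) refl a (x i) (y i))
    (sym (*-distribˡ-sum a (λ i → x i * y i)))

  ∙-self≈0 : ∀ {n} (x : Vector Carrier n) → x ∙ x ≈ 0# → ∀ i → x i ≈ 0#
  ∙-self≈0 x x∙x≈0 i = square≈0 (Nonneg-sum≈0 (λ j → Nonneg-square (x j)) x∙x≈0 i)

  -- Fraction-free Gaussian elimination on the first row.
  underdetermined : ∀ {m} (rows : List (Vector Carrier m)) → length rows ℕ.< m →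
    ¬ (∀ c → All (λ a → a ∙ c ≈ 0#) rows → ∀ j → c j ≈ 0#)
  underdetermined {suc m} [] _ trivial = 1≉0 (trivial (λ _ → 1#) [] zero)
  underdetermined {suc m} (a ∷ rows) (s≤s l<m) trivial =
    underdetermined rows (ℕ.m≤n⇒m≤1+n l<m) λ c solves →
      trivial c (sum-zero (λ j → trans (*-congʳ (a≈0 j)) (zeroˡ (c j))) ∷ solves)
    where
    eliminate : Fin (suc m) → Vector Carrier (suc m) → Vector Carrier m
    eliminate i b j = a i * b (punchIn i j) - b i * a (punchIn i j)

    pivot⇒⊥ : ∀ i → ¬ a i ≈ 0# → ⊥
    pivot⇒⊥ i aᵢ≉0 = underdetermined (map (eliminate i) rows)
      (≡.subst (ℕ._< m) (≡.sym (length-map (eliminate i) rows)) l<m)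
      λ c solves j → cancelˡ (aᵢc≈0 c solves j) aᵢ≉0
      where
      module _ (c : Vector Carrier m) where
        t : Carrier
        t = sum λ j → a (punchIn i j) * c j

        -- Scaling the other coordinates by the pivot `a i` lets the value `- t` at the pivot solve
        -- the first row without division.
        lift : Vector Carrier (suc m)
        lift = insertAt (λ j → a i * c j) i (- t)

        expand : ∀ b → b ∙ lift ≈ b i * - t + sum (λ j → b (punchIn i j) * (a i * c j))
        expand b = begin
          b ∙ lift
            ≈⟨ sum-remove (λ j → b j * lift j) ⟩
          b i * lift i + sum (λ j → b (punchIn i j) * lift (punchIn i j))
            ≈⟨ +-cong (*-congˡ (reflexive (insertAt-lookup (λ j → a i * c j) i (- t))))
                 (sum-cong-≋ λ j → *-congˡ (reflexive (insertAt-punchIn (λ j → a i * c j) i (- t) j))) ⟩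
          b i * - t + sum (λ j → b (punchIn i j) * (a i * c j)) ∎

        lift-row : ∀ b → b ∙ lift ≈ eliminate i b ∙ c
        lift-row b = begin
          b ∙ lift
            ≈⟨ expand b ⟩
          b i * - t + sum (λ j → b (punchIn i j) * (a i * c j))
            ≈⟨ solve 3 (λ b t s → b :* (:- t) :+ s := s :- b :* t) refl (b i) t _ ⟩
          sum (λ j → b (punchIn i j) * (a i * c j)) - b i * t
            ≈⟨ +-congˡ (-‿cong (*-distribˡ-sum (b i) (λ j → a (punchIn i j) * c j))) ⟩
          sum (λ j → b (punchIn i j) * (a i * c j)) - sum (λ j → b i * (a (punchIn i j) * c j))
            ≈⟨ sum-minus (λ j → b (punchIn i j) * (a i * c j)) (λ j → b i * (a (punchIn i j) * c j)) ⟨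
          sum (λ j → b (punchIn i j) * (a i * c j) - b i * (a (punchIn i j) * c j))
            ≈⟨ sum-cong-≋ (λ j → solve 5 (λ bⱼ aᵢ cⱼ bᵢ aⱼ →
                 bⱼ :* (aᵢ :* cⱼ) :- bᵢ :* (aⱼ :* cⱼ) := (aᵢ :* bⱼ :- bᵢ :* aⱼ) :* cⱼ) refl
                 (b (punchIn i j)) (a i) (c j) (b i) (a (punchIn i j))) ⟩
          eliminate i b ∙ c ∎

        lift-a : a ∙ lift ≈ 0#
        lift-a = trans (lift-row a) (sum-zero λ j →
          trans (*-congʳ (-‿inverseʳ (a i * a (punchIn i j)))) (zeroˡ (c j)))

        aᵢc≈0 : All (λ b → b ∙ c ≈ 0#) (map (eliminate i) rows) → ∀ j → a i * c j ≈ 0#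
        aᵢc≈0 solves j = begin
          a i * c j            ≡⟨ insertAt-punchIn (λ j → a i * c j) i (- t) j ⟨
          lift (punchIn i j)   ≈⟨ trivial lift (lift-a ∷ All.map (λ {b} → trans (lift-row b)) (All.map⁻ solves)) (punchIn i j) ⟩
          0#                   ∎

    a≈0 : ∀ j → a j ≈ 0#
    a≈0 j = ≈0-stable (pivot⇒⊥ j)

-- Weighted Laplacians and their energy

module Laplacian (O : OrderedDomain) where

  open OrderedDomain O hiding (zero)
  open OrderedDomainSolver O using (solve; _:+_; _:*_; _:-_; :-_; _:=_)
  open Spectral O
  open Algebra.Properties.Ring ring using (-0#≈0#)
  open Algebra.Properties.Group +-group using () renaming (x∙y⁻¹≈ε⇒x≈y to x-y≈0⇒x≈y)
  open Algebra.Properties.Semiring.Sum semiring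
  open Relation.Binary.Reasoning.Setoid setoid

  size : ℕ → Carrier
  size n = sum {n} λ _ → 1#

  module Weighted {n} (d : Fin n → Fin n → Carrier) where

    laplacian : Vector Carrier n → Vector Carrier n
    laplacian x u = sum λ v → d u v * (x u - x v)

    -- The sum runs over ordered pairs, so for symmetric weights this is twice the bilinear form of
    -- the Laplacian; bounds on it therefore carry each multiple of x ∙ x twice.
    energy : Vector Carrier n → Vector Carrier n → Carrier
    energy x y = sum λ u → sum λ v → d u v * ((x u - x v) * (y u - y v))

    laplacian-sum : ∀ {r} (w : Fin r → Vector Carrier n) u →
      laplacian (λ v → sum λ i → w i v) u ≈ sum λ i → laplacian (w i) u
    laplacian-sum w u = begin
      sum (λ v → d u v * (sum (λ i → w i u) - sum (λ i → w i v)))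
        ≈⟨ sum-cong-≋ (λ v → trans
             (*-congˡ (sym (sum-minus (λ i → w i u) (λ i → w i v))))
             (*-distribˡ-sum (d u v) (λ i → w i u - w i v))) ⟩
      sum (λ v → sum (λ i → d u v * (w i u - w i v)))
        ≈⟨ ∑-comm (λ v i → d u v * (w i u - w i v)) ⟩
      sum (λ i → laplacian (w i) u) ∎

    laplacian-scale : ∀ a x u → laplacian (λ v → a * x v) u ≈ a * laplacian x u
    laplacian-scale a x u = trans
      (sum-cong-≋ λ v → solve 4 (λ a d x y → d :* (a :* x :- a :* y) := a :* (d :* (x :- y)))
        refl a (d u v) (x u) (x v))
      (sym (*-distribˡ-sum a (λ v → d u v * (x u - x v))))

    -- The constant weight 1 contributes `size n` on vectors of sum zero; the weight s(u)s(v)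
    -- contributes its diagonal s(u) · Σ s, its other term being a multiple of s ∙ x. The weights
    -- are compared only after multiplication by differences of `x`, so `d` may deviate where `x` is
    -- constant.
    rank-one-perturbation : ∀ (s x : Vector Carrier n) →
      (∀ u v → d u v * (x u - x v) ≈ (1# + s u * s v) * (x u - x v)) →
      sum x ≈ 0# → s ∙ x ≈ 0# →
      ∀ u → laplacian x u ≈ (size n + s u * sum s) * x u
    rank-one-perturbation s x d≈ ∑x≈0 s∙x≈0 u = begin
      laplacian x u
        ≈⟨ sum-cong-≋ (λ v → trans (d≈ u v) (solve 5 (λ o a b x y →
             (o :+ a :* b) :* (x :- y) :=
             (o :* x :- o :* y) :+ ((a :* x) :* b :- a :* (b :* y))) refl 1# (s u) (s v) (x u) (x v))) ⟩
      sum (λ v → (1# * x u - 1# * x v) + ((s u * x u) * s v - s u * (s v * x v)))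
        ≈⟨ ∑-distrib-+ (λ v → 1# * x u - 1# * x v) (λ v → (s u * x u) * s v - s u * (s v * x v)) ⟩
      sum (λ v → 1# * x u - 1# * x v) + sum (λ v → (s u * x u) * s v - s u * (s v * x v))
        ≈⟨ +-cong (sum-minus (λ _ → 1# * x u) (λ v → 1# * x v))
             (sum-minus (λ v → (s u * x u) * s v) (λ v → s u * (s v * x v))) ⟩
      (sum {n} (λ v → 1# * x u) - sum (λ v → 1# * x v)) +
      (sum (λ v → (s u * x u) * s v) - sum (λ v → s u * (s v * x v)))
        ≈⟨ +-cong
             (+-cong (sym (*-distribʳ-sum {n} (x u) (λ _ → 1#)))
               (-‿cong (trans (sum-cong-≋ λ v → *-identityˡ (x v)) ∑x≈0)))
             (+-cong (sym (*-distribˡ-sum (s u * x u) s))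
               (-‿cong (trans (sym (*-distribˡ-sum (s u) (λ v → s v * x v)))
                 (trans (*-congˡ s∙x≈0) (zeroʳ (s u)))))) ⟩
      (size n * x u - 0#) + ((s u * x u) * sum s - 0#)
        ≈⟨ +-cong (x-0≈x _) (x-0≈x _) ⟩
      size n * x u + (s u * x u) * sum s
        ≈⟨ solve 4 (λ n s x p → n :* x :+ (s :* x) :* p := (n :+ s :* p) :* x)
             refl (size n) (s u) (x u) (sum s) ⟩
      (size n + s u * sum s) * x u ∎
      where
      x-0≈x : ∀ x → x - 0# ≈ x
      x-0≈x x = trans (+-congˡ -0#≈0#) (+-identityʳ x)

    -- `s u * x u ≈ x u` absorbs the factor s(u) in the diagonal term above and turns s ∙ x into the
    -- sum of `x`. It applies to the comparison weights and to the distances of a complete bipartite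
    -- graph.
    supported-eigenvector : ∀ (s x : Vector Carrier n) →
      (∀ u v → d u v * (x u - x v) ≈ (1# + s u * s v) * (x u - x v)) →
      (∀ u → s u * x u ≈ x u) → sum x ≈ 0# →
      ∀ u → laplacian x u ≈ (size n + sum s) * x u
    supported-eigenvector s x d≈ s*x≈x ∑x≈0 u = begin
      laplacian x u
        ≈⟨ rank-one-perturbation s x d≈ ∑x≈0 (trans (sum-cong-≋ s*x≈x) ∑x≈0) u ⟩
      (size n + s u * sum s) * x u
        ≈⟨ solve 4 (λ n s p x → (n :+ s :* p) :* x := n :* x :+ p :* (s :* x))
             refl (size n) (s u) (sum s) (x u) ⟩
      size n * x u + sum s * (s u * x u)
        ≈⟨ +-congˡ (*-congˡ (s*x≈x u)) ⟩
      size n * x u + sum s * x u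
        ≈⟨ distribʳ (x u) (size n) (sum s) ⟨
      (size n + sum s) * x u ∎

    module Symmetric (d-sym : ∀ u v → d u v ≈ d v u) where

      -- The second copy is summed with u and v exchanged; symmetry of `d` then merges the two terms
      -- of each pair into a product of differences.
      ∙-laplacian : ∀ x y → x ∙ laplacian y + x ∙ laplacian y ≈ energy x y
      ∙-laplacian x y = begin
        x ∙ laplacian y + x ∙ laplacian y
          ≈⟨ +-cong expand (trans expand (∑-comm f)) ⟩
        sum (λ u → sum λ v → f u v) + sum (λ u → sum λ v → f v u)
          ≈⟨ ∑-distrib-+ (λ u → sum λ v → f u v) (λ u → sum λ v → f v u) ⟨
        sum (λ u → sum (λ v → f u v) + sum (λ v → f v u))
          ≈⟨ sum-cong-≋ (λ u → trans (sym (∑-distrib-+ (λ v → f u v) (λ v → f v u))) (sum-cong-≋ (merge u))) ⟩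
        energy x y ∎
        where
        f : Fin n → Fin n → Carrier
        f u v = x u * (d u v * (y u - y v))

        expand : x ∙ laplacian y ≈ sum λ u → sum λ v → f u v
        expand = sum-cong-≋ λ u → *-distribˡ-sum (x u) (λ v → d u v * (y u - y v))

        merge : ∀ u v → f u v + f v u ≈ d u v * ((x u - x v) * (y u - y v))
        merge u v = trans
          (+-congˡ (*-congˡ (*-congʳ (d-sym v u))))
          (solve 5 (λ d x x′ y y′ → x :* (d :* (y :- y′)) :+ x′ :* (d :* (y′ :- y)) :=
                                    d :* ((x :- x′) :* (y :- y′)))
            refl (d u v) (x u) (x v) (y u) (y v))

      energy-sym : ∀ x y → energy x y ≈ energy y x
      energy-sym x y = sum-cong-≋ λ u → sum-cong-≋ λ v → *-congˡ (*-comm (x u - x v) (y u - y v))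

      Eigenvector : Carrier → Vector Carrier n → Set
      Eigenvector a x = ∀ u → laplacian x u ≈ a * x u

      energy-eigen : ∀ {a} x {y} → Eigenvector a y → energy x y ≈ a * (x ∙ y) + a * (x ∙ y)
      energy-eigen {a} x {y} eigen = trans (sym (∙-laplacian x y)) (+-cong half half)
        where
        half : x ∙ laplacian y ≈ a * (x ∙ y)
        half = trans (∙-cong (λ _ → refl) eigen) (∙-scaleʳ x y a)

      -- The symmetric form `energy` evaluates both to twice a(x ∙ y) and to twice b(x ∙ y).
      orthogonal : ∀ {a b x y} → ¬ a ≈ b → Eigenvector a x → Eigenvector b y → x ∙ y ≈ 0#
      orthogonal {a} {b} {x} {y} a≉b Lx≈ax Ly≈by =
        cancelˡ (double≈0 doubled) (a≉b ∘ x-y≈0⇒x≈y a b)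
        where
        doubled : (a - b) * (x ∙ y) + (a - b) * (x ∙ y) ≈ 0#
        doubled = begin
          (a - b) * (x ∙ y) + (a - b) * (x ∙ y)
            ≈⟨ solve 3 (λ a b t → (a :- b) :* t :+ (a :- b) :* t := (a :* t :+ a :* t) :- (b :* t :+ b :* t))
                 refl a b (x ∙ y) ⟩
          (a * (x ∙ y) + a * (x ∙ y)) - (b * (x ∙ y) + b * (x ∙ y))
            ≈⟨ +-cong (+-cong a-swap a-swap) (-‿cong (sym (energy-eigen x Ly≈by))) ⟩
          (a * (y ∙ x) + a * (y ∙ x)) - energy x y
            ≈⟨ +-cong (sym (energy-eigen y Lx≈ax)) (-‿cong (energy-sym x y)) ⟩
          energy y x - energy y x
            ≈⟨ -‿inverseʳ (energy y x) ⟩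
          0# ∎
          where
          a-swap : a * (x ∙ y) ≈ a * (y ∙ x)
          a-swap = *-congˡ (sum-cong-≋ λ i → *-comm (x i) (y i))

      -- Orthogonality to the constant vector, which is an eigenvector for 0.
      eigenvector-sum : ∀ {a x} → ¬ a ≈ 0# → Eigenvector a x → sum x ≈ 0#
      eigenvector-sum {a} {x} a≉0 Lx≈ax = trans
        (sym (sum-cong-≋ λ i → *-identityˡ (x i)))
        (orthogonal (a≉0 ∘ sym) constant Lx≈ax)
        where
        constant : Eigenvector 0# (λ _ → 1#)
        constant u = trans
          (sum-zero λ v → trans (*-congˡ (-‿inverseʳ 1#)) (zeroʳ (d u v)))
          (sym (zeroˡ 1#))

      module _ {r} (w : Fin r → Vector Carrier n) (value : Fin r → Carrier)
               (distinct : ∀ i j → i ≢ j → ¬ value i ≈ value j)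
               (eigen : ∀ i → Eigenvector (value i) (w i)) where

        private
          total : Vector Carrier n
          total u = sum λ i → w i u

        -- A weighted Pythagoras: `c` constantly 1 gives the squared norm of the total, and
        -- `c = value` gives its quadratic form.
        ∙-orthogonal-sum : ∀ (c : Vector Carrier r) →
          total ∙ (λ u → sum λ i → c i * w i u) ≈ sum λ i → c i * (w i ∙ w i)
        ∙-orthogonal-sum c = begin
          total ∙ (λ u → sum λ i → c i * w i u)
            ≈⟨ sum-cong-≋ (λ u → *-distribˡ-sum (total u) (λ i → c i * w i u)) ⟩
          sum (λ u → sum λ i → total u * (c i * w i u))
            ≈⟨ ∑-comm (λ u i → total u * (c i * w i u)) ⟩
          sum (λ i → sum λ u → total u * (c i * w i u))
            ≈⟨ sum-cong-≋ (λ i → trans (∙-scaleʳ total (w i) (c i)) (*-congˡ (diagonal i))) ⟩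
          sum (λ i → c i * (w i ∙ w i)) ∎
          where
          diagonal : ∀ i → total ∙ w i ≈ w i ∙ w i
          diagonal i = begin
            total ∙ w i
              ≈⟨ sum-cong-≋ (λ u → *-distribʳ-sum (w i u) (λ j → w j u)) ⟩
            sum (λ u → sum λ j → w j u * w i u)
              ≈⟨ ∑-comm (λ u j → w j u * w i u) ⟩
            sum (λ j → w j ∙ w i)
              ≈⟨ sum-single (λ j → w j ∙ w i) i (λ j j≢i →
                   orthogonal (distinct j i j≢i) (eigen j) (eigen i)) ⟩
            w i ∙ w i ∎

        -- The gap M⟨x,x⟩ − ⟨x,Lx⟩ of x = Σ wᵢ is Σ (M − λᵢ)⟨wᵢ,wᵢ⟩.
        summands-vanish : ∀ {M} →
          (∀ i → Nonneg (M - value i)) → (∀ i → ¬ M ≈ value i) →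
          Nonneg (energy total total - (M * (total ∙ total) + M * (total ∙ total))) →
          ∀ i u → w i u ≈ 0#
        summands-vanish {M} below below≉ 0≤E i =
          ∙-self≈0 (w i) (cancelˡ (Nonneg-sum≈0 0≤gap ∑gap≈0 i) (below≉ i ∘ x-y≈0⇒x≈y M (value i)))
          where
          gap : Vector Carrier r
          gap i = (M - value i) * (w i ∙ w i)

          0≤gap : ∀ i → Nonneg (gap i)
          0≤gap i = Nonneg-* (below i) (Nonneg-sum λ u → Nonneg-square (w i u))

          total∙total : total ∙ total ≈ sum λ i → w i ∙ w i
          total∙total = begin
            total ∙ total
              ≈⟨ ∙-cong (λ _ → refl) (λ u → sum-cong-≋ λ i → sym (*-identityˡ (w i u))) ⟩
            total ∙ (λ u → sum λ i → 1# * w i u)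
              ≈⟨ ∙-orthogonal-sum (λ _ → 1#) ⟩
            sum (λ i → 1# * (w i ∙ w i))
              ≈⟨ sum-cong-≋ (λ i → *-identityˡ (w i ∙ w i)) ⟩
            sum (λ i → w i ∙ w i) ∎

          total∙laplacian : total ∙ laplacian total ≈ sum λ i → value i * (w i ∙ w i)
          total∙laplacian = trans
            (∙-cong (λ _ → refl) λ u → trans (laplacian-sum w u) (sum-cong-≋ λ i → eigen i u))
            (∙-orthogonal-sum value)

          ∑gap : sum gap ≈ M * (total ∙ total) - total ∙ laplacian total
          ∑gap = begin
            sum gap
              ≈⟨ sum-cong-≋ (λ i → solve 3 (λ m a t → (m :- a) :* t := m :* t :- a :* t)
                   refl M (value i) (w i ∙ w i)) ⟩
            sum (λ i → M * (w i ∙ w i) - value i * (w i ∙ w i))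
              ≈⟨ sum-minus (λ i → M * (w i ∙ w i)) (λ i → value i * (w i ∙ w i)) ⟩
            sum (λ i → M * (w i ∙ w i)) - sum (λ i → value i * (w i ∙ w i))
              ≈⟨ +-cong (trans (sym (*-distribˡ-sum M (λ i → w i ∙ w i))) (*-congˡ (sym total∙total)))
                   (-‿cong (sym total∙laplacian)) ⟩
            M * (total ∙ total) - total ∙ laplacian total ∎

          ∑gap≈0 : sum gap ≈ 0#
          -- The energy hypothesis says that minus twice the total gap is nonnegative. As every gap
          -- is nonnegative too, the total is squeezed to zero.
          ∑gap≈0 = double≈0 (Nonneg-antisym
            (Nonneg-+ (Nonneg-sum 0≤gap) (Nonneg-sum 0≤gap))
            (Nonneg-resp (begin
              energy total total - (M * (total ∙ total) + M * (total ∙ total))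
                ≈⟨ +-congʳ (sym (∙-laplacian total total)) ⟩
              (total ∙ laplacian total + total ∙ laplacian total) -
              (M * (total ∙ total) + M * (total ∙ total))
                ≈⟨ solve 2 (λ l m → (l :+ l) :- (m :+ m) := :- ((m :- l) :+ (m :- l)))
                     refl (total ∙ laplacian total) (M * (total ∙ total)) ⟩
              - ((M * (total ∙ total) - total ∙ laplacian total) +
                 (M * (total ∙ total) - total ∙ laplacian total))
                ≈⟨ -‿cong (+-cong (sym ∑gap) (sym ∑gap)) ⟩
              - (sum gap + sum gap) ∎) 0≤E))

  module _ {n} (d : Fin n → Fin n → Carrier) (d-sym : ∀ u v → d u v ≈ d v u) where

    open Weighted d
    open Symmetric d-sym

    -- `x` is an eigenvector for the weights 1 + s(u)s(v), so its energy there is exactly the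
    -- subtracted term; the rest is a sum of weight excesses times squares.
    energy-lower-bound : ∀ (s x : Vector Carrier n) →
      (∀ u v → u ≢ v → Nonneg (d u v - (1# + s u * s v))) →
      (∀ u → s u * x u ≈ x u) → sum x ≈ 0# →
      Nonneg (energy x x - ((size n + sum s) * (x ∙ x) + (size n + sum s) * (x ∙ x)))
    energy-lower-bound s x dominates s*x≈x ∑x≈0 =
      Nonneg-resp (begin
        sum (λ u → sum λ v → (d u v - e u v) * ((x u - x v) * (x u - x v)))
          ≈⟨ sum-cong-≋ (λ u → trans
               (sum-cong-≋ λ v → solve 3 (λ d e t → (d :- e) :* t := d :* t :- e :* t)
                 refl (d u v) (e u v) ((x u - x v) * (x u - x v)))
               (sum-minus (λ v → d u v * ((x u - x v) * (x u - x v)))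
                          (λ v → e u v * ((x u - x v) * (x u - x v))))) ⟩
        sum (λ u → sum (λ v → d u v * ((x u - x v) * (x u - x v))) -
                   sum (λ v → e u v * ((x u - x v) * (x u - x v))))
          ≈⟨ sum-minus (λ u → sum λ v → d u v * ((x u - x v) * (x u - x v)))
               (λ u → sum λ v → e u v * ((x u - x v) * (x u - x v))) ⟩
        energy x x - E.energy x x
          ≈⟨ +-congˡ (-‿cong (E.Symmetric.energy-eigen e-sym x e-eigen)) ⟩
        energy x x - ((size n + sum s) * (x ∙ x) + (size n + sum s) * (x ∙ x)) ∎)
        (Nonneg-sum λ u → Nonneg-sum λ v → 0≤term u v)
      where
      e : Fin n → Fin n → Carrier
      e u v = 1# + s u * s v

      module E = Weighted e

      e-sym : ∀ u v → e u v ≈ e v u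
      e-sym u v = +-congˡ (*-comm (s u) (s v))

      e-eigen : ∀ u → E.laplacian x u ≈ (size n + sum s) * x u
      e-eigen = E.supported-eigenvector s x (λ _ _ → refl) s*x≈x ∑x≈0

      0≤term : ∀ u v → Nonneg ((d u v - e u v) * ((x u - x v) * (x u - x v)))
      0≤term u v with u Fin.≟ v
      ... | no u≢v = Nonneg-* (dominates u v u≢v) (Nonneg-square (x u - x v))
      -- The weights are compared only off the diagonal; here the difference of `x` kills the term.
      ... | yes ≡.refl = Nonneg-resp (sym (begin
        (d u u - e u u) * ((x u - x u) * (x u - x u))
          ≈⟨ *-congˡ (*-congʳ (-‿inverseʳ (x u))) ⟩
        (d u u - e u u) * (0# * (x u - x u))
          ≈⟨ *-congˡ (zeroˡ (x u - x u)) ⟩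
        (d u u - e u u) * 0#
          ≈⟨ zeroʳ (d u u - e u u) ⟩
        0# ∎)) Nonneg-0

-- Families of vectors split into blocks

flatten : ∀ {r} {A : Set} (mult : Vector ℕ r) →
          (∀ i → Vector A (mult i)) → Vector A (∑ᴺ mult)
flatten {suc r} mult f = f zero ++ flatten (mult ∘ suc) (λ i → f (suc i))

index : ∀ {r} (mult : Vector ℕ r) i → Fin (mult i) → Fin (∑ᴺ mult)
index mult zero    j = j ↑ˡ _
index mult (suc i) j = mult zero ↑ʳ index (mult ∘ suc) i j

flatten-index : ∀ {r} {A : Set} (mult : Vector ℕ r) (f : ∀ i → Vector A (mult i)) i j →
                flatten mult f (index mult i j) ≡ f i j
flatten-index mult f zero    j = lookup-++ˡ (f zero) _ j
flatten-index mult f (suc i) j =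
  ≡.trans (lookup-++ʳ (f zero) (flatten (mult ∘ suc) (λ i → f (suc i))) (index (mult ∘ suc) i j))
    (flatten-index (mult ∘ suc) (λ i → f (suc i)) i j)

index-elim : ∀ {r} (mult : Vector ℕ r) (P : Fin (∑ᴺ mult) → Set) →
             (∀ i j → P (index mult i j)) → ∀ k → P k
index-elim {suc r} mult P p k with splitAt (mult zero) k in eq
... | inj₁ j  = ≡.subst P (Fin.splitAt⁻¹-↑ˡ eq) (p zero j)
... | inj₂ k′ = ≡.subst P (Fin.splitAt⁻¹-↑ʳ eq)
  (index-elim (mult ∘ suc) (P ∘ (mult zero ↑ʳ_)) (λ i → p (suc i)) k′)

-- The dimension count

module EigenvalueCount (O : OrderedDomain) where

  open OrderedDomain O hiding (zero)
  open OrderedDomainSolver O using (solve; _:+_; _:*_; _:-_; _:=_)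
  open Spectral O
  open Laplacian O
  open Algebra.Properties.Semiring.Sum semiring
  open Relation.Binary.Reasoning.Setoid setoid

  sum-index : ∀ {r} (mult : Vector ℕ r) (f : Vector Carrier (∑ᴺ mult)) →
              sum f ≈ sum λ i → sum λ j → f (index mult i j)
  sum-index {zero}  mult f = refl
  sum-index {suc r} mult f = trans (sum-↑ (mult zero) f)
    (+-congˡ (sum-index (mult ∘ suc) (λ k → f (mult zero ↑ʳ k))))

  indicator : ∀ {n} → Fin n → Vector Carrier n
  indicator i j = if does (i Fin.≟ j) then 1# else 0#

  indicator-∙ : ∀ {n} (c : Vector Carrier n) i → sum (λ j → c j * indicator i j) ≈ c i
  indicator-∙ c i = begin
    sum (λ j → c j * indicator i j)
      ≈⟨ sum-single (λ j → c j * indicator i j) i (λ j j≢i →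
           trans (*-congˡ (reflexive (≡.cong (if_then 1# else 0#) (dec-false (i Fin.≟ j) (j≢i ∘ ≡.sym)))))
             (zeroʳ (c j))) ⟩
    c i * indicator i i
      ≈⟨ *-congˡ (reflexive (≡.cong (if_then 1# else 0#) (dec-true (i Fin.≟ i) ≡.refl))) ⟩
    c i * 1#
      ≈⟨ *-identityʳ (c i) ⟩
    c i ∎

  module _ {n} (d : Fin n → Fin n → Carrier) (d-sym : ∀ u v → d u v ≈ d v u) where

    open Weighted d
    open Symmetric d-sym

    combination-eigen : ∀ {a k} (c : Vector Carrier k) (x : Vector (Vector Carrier n) k) →
      (∀ j → Eigenvector a (x j)) → Eigenvector a (λ u → sum λ j → c j * x j u)
    combination-eigen {a} c x eigen u = begin
      laplacian (λ u → sum λ j → c j * x j u) u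
        ≈⟨ laplacian-sum (λ j u → c j * x j u) u ⟩
      sum (λ j → laplacian (λ u → c j * x j u) u)
        ≈⟨ sum-cong-≋ (λ j → trans (laplacian-scale (c j) (x j) u) (trans (*-congˡ (eigen j u))
             (solve 3 (λ c a x → c :* (a :* x) := a :* (c :* x)) refl (c j) a (x j u)))) ⟩
      sum (λ j → a * (c j * x j u))
        ≈⟨ *-distribˡ-sum a (λ j → c j * x j u) ⟨
      a * sum (λ j → c j * x j u) ∎

    module _
      -- `s` is meant as the indicator of the colour class S, and `outside` as the list of vertices
      -- off S; `supported` links the two. `comp` is meant to number the components of the
      -- complement.
      (s : Vector Carrier n) (outside : List (Fin n))
      (supported : ∀ (x : Vector Carrier n) → All (λ u → x u ≈ 0#) outside → ∀ u → s u * x u ≈ x u)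
      (dominates : ∀ u v → u ≢ v → Nonneg (d u v - (1# + s u * s v)))
      (0≤∑s : Nonneg (sum s)) (∑s≉0 : ¬ sum s ≈ 0#)
      {C} (comp : Fin n → Fin C) (comp-surjective : ∀ i → ∃ λ u → comp u ≡ i)
      (across : ∀ u v → comp u ≢ comp v → d u v ≈ 1#)
      {r} (value : Vector Carrier r) (mult : Vector ℕ r)
      (x : ∀ i → Vector (Vector Carrier n) (mult i))
      (eigen : ∀ i j → Eigenvector (value i) (x i j))
      (independent : ∀ i (c : Vector Carrier (mult i)) →
        (∀ u → sum (λ j → c j * x i j u) ≈ 0#) → ∀ j → c j ≈ 0#)
      (distinct : ∀ i j → i ≢ j → ¬ value i ≈ value j)
      (value≉0 : ∀ i → ¬ value i ≈ 0#)
      (value≉n : ∀ i → ¬ value i ≈ size n)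
      (below : ∀ i → Nonneg ((size n + sum s) - value i))
      (below≉ : ∀ i → ¬ (size n + sum s) ≈ value i)
      where

      private
        -- The indicators of the components form an extra block; the part of
        -- a combination that they contribute is an n-eigenvector once its
        -- entries sum to zero.
        value⁺ : Vector Carrier (suc r)
        value⁺ = size n Vec.∷ value

        mult⁺ : Vector ℕ (suc r)
        mult⁺ = C Vec.∷ mult

        x⁺ : ∀ i → Vector (Vector Carrier n) (mult⁺ i)
        x⁺ zero    j u = indicator (comp u) j
        x⁺ (suc i) = x i

        column : Vector (Vector Carrier n) (∑ᴺ mult⁺)
        column = flatten mult⁺ x⁺

        rows : List (Vector Carrier (∑ᴺ mult⁺))
        rows = (λ k → sum (column k)) ∷ map (λ u k → column k u) outside

        module _ (c : Vector Carrier (∑ᴺ mult⁺)) (solves : All (λ a → a ∙ c ≈ 0#) rows) where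

          part : Fin (suc r) → Vector Carrier n
          part i u = sum λ j → c (index mult⁺ i j) * x⁺ i j u

          total : Vector Carrier n
          total u = sum λ i → part i u

          column∙c : ∀ u → sum (λ k → column k u * c k) ≈ total u
          column∙c u = trans (sum-index mult⁺ (λ k → column k u * c k))
            (sum-cong-≋ λ i → sum-cong-≋ λ j → trans
              (*-comm (column (index mult⁺ i j) u) (c (index mult⁺ i j)))
              (*-congˡ (reflexive (≡.cong (λ y → y u) (flatten-index mult⁺ x⁺ i j)))))

          sum-total : sum total ≈ 0#
          sum-total = begin
            sum total                             ≈⟨ sum-cong-≋ column∙c ⟨
            sum (λ u → sum λ k → column k u * c k) ≈⟨ ∑-comm (λ u k → column k u * c k) ⟩
            sum (λ k → sum λ u → column k u * c k) ≈⟨ sum-cong-≋ (λ k → *-distribʳ-sum (c k) (column k)) ⟨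
            sum (λ k → sum (column k) * c k)      ≈⟨ All.head solves ⟩
            0#                                    ∎

          total-supported : ∀ u → s u * total u ≈ total u
          total-supported = supported total
            (All.map (λ {u} → trans (sym (column∙c u))) (All.map⁻ (All.tail solves)))

          part-eigen : ∀ i → Eigenvector (value i) (part (suc i))
          part-eigen i = combination-eigen (λ j → c (index mult⁺ (suc i) j)) (x i) (eigen i)

          -- The other parts are eigenvectors for nonzero values and have sum zero already, so the
          -- equation on the sum of `total` falls on the indicator part alone.
          sum-part : sum (part zero) ≈ 0#
          sum-part = begin
            sum (part zero)
              ≈⟨ +-identityʳ _ ⟨
            sum (part zero) + 0#
              ≈⟨ +-congˡ (sum-zero λ i → eigenvector-sum (value≉0 i) (part-eigen i)) ⟨
            sum (part zero) + sum (λ i → sum (part (suc i)))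
              ≈⟨ ∑-comm (λ u i → part i u) ⟨
            sum total
              ≈⟨ sum-total ⟩
            0# ∎

          -- Inside a component the weight may differ from 1, but there `part zero` is constant;
          -- across components the weight is 1. This is the hypothesis of `rank-one-perturbation`
          -- for s = 0.
          part-constant : ∀ u v → d u v * (part zero u - part zero v) ≈
                                  (1# + 0# * 0#) * (part zero u - part zero v)
          part-constant u v with comp u Fin.≟ comp v
          ... | no cu≢cv = *-congʳ (trans (across u v cu≢cv)
            (sym (trans (+-congˡ (zeroˡ 0#)) (+-identityʳ 1#))))
          ... | yes cu≡cv = trans (*-congˡ zero-difference)
            (trans (zeroʳ _) (sym (trans (*-congˡ zero-difference) (zeroʳ _))))
            where
            zero-difference : part zero u - part zero v ≈ 0#
            zero-difference = trans (+-congʳ (reflexive (≡.cong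
              (λ k → sum λ j → c (index mult⁺ zero j) * indicator k j) cu≡cv)))
              (-‿inverseʳ (part zero v))

          part⁺-eigen : ∀ i → Eigenvector (value⁺ i) (part i)
          part⁺-eigen (suc i) = part-eigen i
          part⁺-eigen zero u = trans
            (rank-one-perturbation (λ _ → 0#) (part zero) part-constant sum-part
              (sum-zero λ v → zeroˡ (part zero v)) u)
            (*-congʳ (trans (+-congˡ (zeroˡ _)) (+-identityʳ (size n))))

          -- Orthogonality to the indicator block requires that no given value equals `size n`; the
          -- open left end of the window will ensure this.
          distinct⁺ : ∀ i j → i ≢ j → ¬ value⁺ i ≈ value⁺ j
          distinct⁺ zero    zero    i≢j = contradiction ≡.refl i≢j
          distinct⁺ zero    (suc j) _   = value≉n j ∘ sym
          distinct⁺ (suc i) zero    _   = value≉n i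
          distinct⁺ (suc i) (suc j) i≢j = distinct i j (i≢j ∘ ≡.cong suc)

          n+s-n : (size n + sum s) - size n ≈ sum s
          n+s-n = solve 2 (λ n s → (n :+ s) :- n := s) refl (size n) (sum s)

          below⁺ : ∀ i → Nonneg ((size n + sum s) - value⁺ i)
          below⁺ zero    = Nonneg-resp (sym n+s-n) 0≤∑s
          below⁺ (suc i) = below i

          below⁺≉ : ∀ i → ¬ (size n + sum s) ≈ value⁺ i
          below⁺≉ zero    M≈n = ∑s≉0 (trans (sym n+s-n) (trans (+-congʳ M≈n) (-‿inverseʳ (size n))))
          below⁺≉ (suc i) = below≉ i

          part≈0 : ∀ i u → part i u ≈ 0#
          part≈0 = summands-vanish part value⁺ distinct⁺ part⁺-eigen below⁺ below⁺≉
            (energy-lower-bound d d-sym s total dominates total-supported sum-total)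

          c≈0 : ∀ i j → c (index mult⁺ i j) ≈ 0#
          c≈0 (suc i) = independent i (λ j → c (index mult⁺ (suc i) j)) (part≈0 (suc i))
          -- At any vertex of component `j`, the entry of `part zero` is the `j`-th coefficient
          -- itself.
          c≈0 zero j with comp-surjective j
          ... | u , ≡.refl = trans (sym (indicator-∙ (λ j → c (index mult⁺ zero j)) (comp u)))
            (part≈0 zero u)

      -- The left side counts the columns and the right side the equations; with more columns than
      -- equations, `c≈0` would contradict `underdetermined`.
      eigenvalue-count : C ℕ.+ ∑ᴺ mult ℕ.≤ suc (length outside)
      eigenvalue-count = ℕ.≮⇒≥ λ few-rows → underdetermined rows
        (≡.subst (ℕ._< ∑ᴺ mult⁺) (≡.cong suc (≡.sym (length-map (λ u k → column k u) outside))) few-rows)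
        λ c solves → index-elim mult⁺ (λ k → c k ≈ 0#) (c≈0 c solves)

-- The reals form an ordered domain

module Real where

  open Defs using (_≈_; _<_; _+_; _*_; fromℤ; fromℕ; 0ℝ)
  open +-*-Solver using (solve; _:+_; _:*_; _:-_; :-_; _:=_; con)

  Eventually : (ℕ → Set) → Set
  Eventually P = ∃ λ N → ∀ n → N ℕ.≤ n → P n

  always : ∀ {P : ℕ → Set} → (∀ n → P n) → Eventually P
  always p = 0 , λ n _ → p n

  eventually-map : ∀ {P Q : ℕ → Set} → (∀ {n} → P n → Q n) → Eventually P → Eventually Q
  eventually-map f (N , p) = N , λ n N≤n → f (p n N≤n)

  eventually-map₂ : ∀ {P Q R : ℕ → Set} → (∀ {n} → P n → Q n → R n) →
                    Eventually P → Eventually Q → Eventually R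
  eventually-map₂ f (M , p) (N , q) = M ℕ.⊔ N , λ n M⊔N≤n →
    f (p n (ℕ.m⊔n≤o⇒m≤o M N M⊔N≤n)) (q n (ℕ.m⊔n≤o⇒n≤o M N M⊔N≤n))

  eventually-const : ∀ {P : Set} → Eventually (λ _ → P) → P
  eventually-const (N , p) = p N ℕ.≤-refl

  abstract
    half : ∀ {ε} → 0ℚ ℚ.< ε → ∃ λ δ → 0ℚ ℚ.< δ × δ ℚ.+ δ ≡ ε
    half {ε} 0<ε = ½ ℚ.* ε
      , ≡.subst (ℚ._< ½ ℚ.* ε) (ℚ.*-zeroʳ ½) (ℚ.*-monoʳ-<-pos ½ 0<ε)
      , solve 1 (λ ε → con ½ :* ε :+ con ½ :* ε := ε) ≡.refl ε

    quotient : ∀ {B ε} → 0ℚ ℚ.< B → 0ℚ ℚ.< ε → ∃ λ δ → 0ℚ ℚ.< δ × B ℚ.* δ ≡ ε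
    quotient {B} {ε} 0<B 0<ε = ℚ.1/ B ℚ.* ε
      , ≡.subst (ℚ._< ℚ.1/ B ℚ.* ε) (ℚ.*-zeroʳ (ℚ.1/ B)) (ℚ.*-monoʳ-<-pos (ℚ.1/ B) 0<ε)
      , ≡.trans (≡.sym (ℚ.*-assoc B (ℚ.1/ B) ε))
          (≡.trans (≡.cong (ℚ._* ε) (ℚ.*-inverseʳ B)) (ℚ.*-identityˡ ε))
      where instance
        B-positive : ℚ.Positive B
        B-positive = ℚ.positive 0<B
        B-nonZero : ℚ.NonZero B
        B-nonZero = ℚ.pos⇒nonZero B
        1/B-positive : ℚ.Positive (ℚ.1/ B)
        1/B-positive = ℚ.1/pos⇒pos B

  -p≤∣p∣ : ∀ p → ℚ.- p ℚ.≤ ℚ.∣ p ∣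
  -p≤∣p∣ p with ℚ.∣p∣≡p∨∣p∣≡-p p
  ... | inj₂ ∣p∣≡-p = ℚ.≤-reflexive (≡.sym ∣p∣≡-p)
  ... | inj₁ ∣p∣≡p  = ℚ.≤-trans (ℚ.neg-antimono-≤ (ℚ.∣p∣≡p⇒0≤p ∣p∣≡p)) (ℚ.0≤∣p∣ p)

  p≤∣p∣ : ∀ p → p ℚ.≤ ℚ.∣ p ∣
  p≤∣p∣ p = ≡.subst₂ ℚ._≤_ (solve 1 (λ p → :- (:- p) := p) ≡.refl p) (ℚ.∣-p∣≡∣p∣ p) (-p≤∣p∣ (ℚ.- p))

  ∣p∣≤ : ∀ p {ε} → p ℚ.≤ ε → ℚ.- p ℚ.≤ ε → ℚ.∣ p ∣ ℚ.≤ ε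
  ∣p∣≤ p p≤ε -p≤ε with ℚ.∣p∣≡p∨∣p∣≡-p p
  ... | inj₁ ∣p∣≡p  = ≡.subst (ℚ._≤ _) (≡.sym ∣p∣≡p) p≤ε
  ... | inj₂ ∣p∣≡-p = ≡.subst (ℚ._≤ _) (≡.sym ∣p∣≡-p) -p≤ε

  ∣p+q∣≤ : ∀ p q ε δ → ℚ.∣ p ∣ ℚ.≤ ε → ℚ.∣ q ∣ ℚ.≤ δ → ℚ.∣ p ℚ.+ q ∣ ℚ.≤ ε ℚ.+ δ
  ∣p+q∣≤ p q ε δ p≤ε q≤δ = ℚ.≤-trans (ℚ.∣p+q∣≤∣p∣+∣q∣ p q) (ℚ.+-mono-≤ p≤ε q≤δ)

  ∣p*q∣≤ : ∀ p q ε δ → ℚ.∣ p ∣ ℚ.≤ ε → ℚ.∣ q ∣ ℚ.≤ δ → ℚ.∣ p ℚ.* q ∣ ℚ.≤ ε ℚ.* δ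
  ∣p*q∣≤ p q ε δ p≤ε q≤δ = begin
    ℚ.∣ p ℚ.* q ∣        ≡⟨ ℚ.∣p*q∣≡∣p∣*∣q∣ p q ⟩
    ℚ.∣ p ∣ ℚ.* ℚ.∣ q ∣  ≤⟨ ℚ.*-monoʳ-≤-nonNeg ℚ.∣ q ∣ {{ℚ.∣-∣-nonNeg q}} p≤ε ⟩
    ε ℚ.* ℚ.∣ q ∣        ≤⟨ ℚ.*-monoˡ-≤-nonNeg ε {{ℚ.nonNegative (ℚ.≤-trans (ℚ.0≤∣p∣ p) p≤ε)}} q≤δ ⟩
    ε ℚ.* δ              ∎
    where open ℚ.≤-Reasoning

  -- `x ≈ y` is definitionally `Null` of the termwise difference, so laws of `≈` reduce to rational
  -- identities between differences.
  Null : (ℕ → ℚ) → Set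
  Null s = ∀ ε → 0ℚ ℚ.< ε → Eventually λ n → ℚ.∣ s n ∣ ℚ.≤ ε

  Bounded : (ℕ → ℚ) → Set
  Bounded s = ∃ λ B → 0ℚ ℚ.< B × Eventually λ n → ℚ.∣ s n ∣ ℚ.≤ B

  null-cong : ∀ {s t : ℕ → ℚ} → (∀ n → s n ≡ t n) → Null s → Null t
  null-cong s≡t null ε 0<ε =
    eventually-map (λ {n} → ≡.subst (λ p → ℚ.∣ p ∣ ℚ.≤ ε) (s≡t n)) (null ε 0<ε)

  null-0 : Null (λ _ → 0ℚ)
  null-0 ε 0<ε = always λ _ → ℚ.<⇒≤ 0<ε

  null-neg : ∀ {s} → Null s → Null (λ n → ℚ.- s n)
  null-neg {s} null ε 0<ε =
    eventually-map (λ {n} → ≡.subst (ℚ._≤ ε) (≡.sym (ℚ.∣-p∣≡∣p∣ (s n)))) (null ε 0<ε)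

  null-+ : ∀ {s t} → Null s → Null t → Null (λ n → s n ℚ.+ t n)
  null-+ {s} {t} s-null t-null ε 0<ε = let δ , 0<δ , δ+δ≡ε = half 0<ε in eventually-map₂
    (λ {n} s≤δ t≤δ → ≡.subst (ℚ.∣ s n ℚ.+ t n ∣ ℚ.≤_) δ+δ≡ε (∣p+q∣≤ (s n) (t n) δ δ s≤δ t≤δ))
    (s-null δ 0<δ) (t-null δ 0<δ)

  null-* : ∀ {s t} → Bounded s → Null t → Null (λ n → s n ℚ.* t n)
  null-* {s} {t} (B , 0<B , s≤B) t-null ε 0<ε = let δ , 0<δ , Bδ≡ε = quotient 0<B 0<ε in eventually-map₂
    (λ {n} s≤B t≤δ → ≡.subst (ℚ.∣ s n ℚ.* t n ∣ ℚ.≤_) Bδ≡ε (∣p*q∣≤ (s n) (t n) B δ s≤B t≤δ))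
    s≤B (t-null δ 0<δ)

  regroup : ∀ a b → a ≡ b ℚ.+ (a ℚ.- b)
  regroup = solve 2 (λ a b → a := b :+ (a :- b)) ≡.refl

  bounded : ∀ x → Bounded (seq x)
  bounded x = let N , close = cauchy x 1ℚ (ℚ.positive⁻¹ 1ℚ) in ℚ.∣ seq x N ∣ ℚ.+ 1ℚ
    , ℚ.+-mono-≤-< (ℚ.0≤∣p∣ (seq x N)) (ℚ.positive⁻¹ 1ℚ)
    , N , λ n N≤n → begin
      ℚ.∣ seq x n ∣
        ≡⟨ ≡.cong ℚ.∣_∣ (regroup (seq x n) (seq x N)) ⟩
      ℚ.∣ seq x N ℚ.+ (seq x n ℚ.- seq x N) ∣
        ≤⟨ ℚ.∣p+q∣≤∣p∣+∣q∣ (seq x N) (seq x n ℚ.- seq x N) ⟩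
      ℚ.∣ seq x N ∣ ℚ.+ ℚ.∣ seq x n ℚ.- seq x N ∣
        ≤⟨ ℚ.+-monoʳ-≤ ℚ.∣ seq x N ∣ (close n N N≤n ℕ.≤-refl) ⟩
      ℚ.∣ seq x N ∣ ℚ.+ 1ℚ ∎
    where open ℚ.≤-Reasoning

  ≗⇒≈ : ∀ {x y} → (∀ n → seq x n ≡ seq y n) → x ≈ y
  ≗⇒≈ {x} {y} x≗y = null-cong
    (λ n → ≡.trans (≡.sym (ℚ.+-inverseʳ (seq y n))) (≡.cong (ℚ._- seq y n) (≡.sym (x≗y n)))) null-0

  ≈-refl : ∀ {x} → x ≈ x
  ≈-refl {x} = ≗⇒≈ {x} {x} λ _ → ≡.refl

  ≈-sym : ∀ {x y} → x ≈ y → y ≈ x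
  ≈-sym {x} {y} x≈y = null-cong
    (λ n → solve 2 (λ a b → :- (a :- b) := b :- a) ≡.refl (seq x n) (seq y n)) (null-neg x≈y)

  ≈-trans : ∀ {x y z} → x ≈ y → y ≈ z → x ≈ z
  ≈-trans {x} {y} {z} x≈y y≈z = null-cong
    (λ n → solve 3 (λ a b c → (a :- b) :+ (b :- c) := a :- c) ≡.refl (seq x n) (seq y n) (seq z n))
    (null-+ x≈y y≈z)

  +-cong : ∀ {x x′ y y′} → x ≈ x′ → y ≈ y′ → x + y ≈ x′ + y′
  +-cong {x} {x′} {y} {y′} x≈x′ y≈y′ = null-cong
    (λ n → solve 4 (λ a b c d → (a :- b) :+ (c :- d) := (a :+ c) :- (b :+ d)) ≡.refl
      (seq x n) (seq x′ n) (seq y n) (seq y′ n))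
    (null-+ x≈x′ y≈y′)

  *-cong : ∀ {x x′ y y′} → x ≈ x′ → y ≈ y′ → x * y ≈ x′ * y′
  *-cong {x} {x′} {y} {y′} x≈x′ y≈y′ = null-cong
    (λ n → solve 4 (λ a b c d → a :* (c :- d) :+ d :* (a :- b) := a :* c :- b :* d) ≡.refl
      (seq x n) (seq x′ n) (seq y n) (seq y′ n))
    (null-+ (null-* (bounded x) y≈y′) (null-* (bounded y′) x≈x′))

  neg : ℝ → ℝ
  neg x = mkℝ (λ n → ℚ.- seq x n) λ ε 0<ε → let N , close = cauchy x ε 0<ε in
    N , λ m n N≤m N≤n → ≡.subst (ℚ._≤ ε)
      (≡.trans (≡.sym (ℚ.∣-p∣≡∣p∣ (seq x m ℚ.- seq x n)))
        (≡.cong ℚ.∣_∣ (solve 2 (λ a b → :- (a :- b) := (:- a) :- (:- b)) ≡.refl (seq x m) (seq x n))))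
      (close m n N≤m N≤n)

  neg-cong : ∀ {x y} → x ≈ y → neg x ≈ neg y
  neg-cong {x} {y} x≈y = null-cong
    (λ n → solve 2 (λ a b → :- (a :- b) := (:- a) :- (:- b)) ≡.refl (seq x n) (seq y n)) (null-neg x≈y)

  -- Unlike _≈_, this does not unfold, so its arguments are compared as reals
  -- and not as expressions in ℚ.
  infix 4 _≋_

  record _≋_ (x y : ℝ) : Set where
    constructor wrap
    field unwrap : x ≈ y

  open _≋_ public

  ≗⇒≋ : ∀ {x y} → (∀ n → seq x n ≡ seq y n) → x ≋ y
  ≗⇒≋ {x} {y} x≗y = wrap (≗⇒≈ {x} {y} x≗y)

  ℝ-commutativeRing : CommutativeRing 0ℓ 0ℓ
  ℝ-commutativeRing = record
    { Carrier = ℝ ; _≈_ = _≋_ ; _+_ = _+_ ; _*_ = _*_ ; -_ = neg ; 0# = 0ℝ ; 1# = fromℕ 1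
    ; isCommutativeRing = record
      { isRing = record
        { +-isAbelianGroup = record
          { isGroup = record
            { isMonoid = record
              { isSemigroup = record
                { isMagma = record
                  { isEquivalence = record
                    { refl = λ {x} → wrap (≈-refl {x})
                    ; sym = λ {x} {y} x≋y → wrap (≈-sym {x} {y} (unwrap x≋y))
                    ; trans = λ {x} {y} {z} x≋y y≋z → wrap (≈-trans {x} {y} {z} (unwrap x≋y) (unwrap y≋z)) }
                  ; ∙-cong = λ {x} {x′} {y} {y′} x≋x′ y≋y′ →
                    wrap (+-cong {x} {x′} {y} {y′} (unwrap x≋x′) (unwrap y≋y′)) }
                ; assoc = λ x y z → ≗⇒≋ λ n → ℚ.+-assoc (seq x n) (seq y n) (seq z n) }
              ; identity = (λ x → ≗⇒≋ λ n → ℚ.+-identityˡ (seq x n))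
                         , (λ x → ≗⇒≋ λ n → ℚ.+-identityʳ (seq x n)) }
            ; inverse = (λ x → ≗⇒≋ λ n → ℚ.+-inverseˡ (seq x n))
                      , (λ x → ≗⇒≋ λ n → ℚ.+-inverseʳ (seq x n))
            ; ⁻¹-cong = λ {x} {y} x≋y → wrap (neg-cong {x} {y} (unwrap x≋y)) }
          ; comm = λ x y → ≗⇒≋ λ n → ℚ.+-comm (seq x n) (seq y n) }
        ; *-cong = λ {x} {x′} {y} {y′} x≋x′ y≋y′ →
            wrap (*-cong {x} {x′} {y} {y′} (unwrap x≋x′) (unwrap y≋y′))
        ; *-assoc = λ x y z → ≗⇒≋ λ n → ℚ.*-assoc (seq x n) (seq y n) (seq z n)
        ; *-identity = (λ x → ≗⇒≋ λ n → ℚ.*-identityˡ (seq x n))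
                     , (λ x → ≗⇒≋ λ n → ℚ.*-identityʳ (seq x n))
        ; distrib = (λ x y z → ≗⇒≋ λ n → ℚ.*-distribˡ-+ (seq x n) (seq y n) (seq z n))
                  , (λ x y z → ≗⇒≋ λ n → ℚ.*-distribʳ-+ (seq x n) (seq y n) (seq z n)) }
      ; *-comm = λ x y → ≗⇒≋ λ n → ℚ.*-comm (seq x n) (seq y n) } }

  -- `ℚ._/_` cancels a gcd and is stuck on a variable numerator. The laws of `fromℤ` are therefore
  -- checked on unnormalised fractions; the `0` here encodes denominator 1.
  toℚᵘ-/1 : ∀ i → ℚ.toℚᵘ (i ℚ./ 1) ℚᵘ.≃ mkℚᵘ i 0
  toℚᵘ-/1 i = ℚ.toℚᵘ-fromℚᵘ (mkℚᵘ i 0)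

  /1-+ : ∀ i j → (i ℤ.+ j) ℚ./ 1 ≡ i ℚ./ 1 ℚ.+ j ℚ./ 1
  /1-+ i j = ℚ.toℚᵘ-injective (begin
    ℚ.toℚᵘ ((i ℤ.+ j) ℚ./ 1)                    ≈⟨ toℚᵘ-/1 (i ℤ.+ j) ⟩
    mkℚᵘ (i ℤ.+ j) 0                            ≈⟨ ℚᵘ.*≡* (cross-multiplied i j) ⟩
    mkℚᵘ i 0 ℚᵘ.+ mkℚᵘ j 0                      ≈⟨ ℚᵘ.+-cong (toℚᵘ-/1 i) (toℚᵘ-/1 j) ⟨
    ℚ.toℚᵘ (i ℚ./ 1) ℚᵘ.+ ℚ.toℚᵘ (j ℚ./ 1)      ≈⟨ ℚ.toℚᵘ-homo-+ (i ℚ./ 1) (j ℚ./ 1) ⟨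
    ℚ.toℚᵘ (i ℚ./ 1 ℚ.+ j ℚ./ 1)                ∎)
    where
    open ℚᵘ.≃-Reasoning
    cross-multiplied : ∀ i j →
      (i ℤ.+ j) ℤ.* + 1 ≡ (i ℤ.* + 1 ℤ.+ j ℤ.* + 1) ℤ.* + 1
    cross-multiplied = ℤSolver.solve 2 (λ i j →
      (i ℤSolver.:+ j) ℤSolver.:* one ℤSolver.:=
      (i ℤSolver.:* one ℤSolver.:+ j ℤSolver.:* one) ℤSolver.:* one) ≡.refl
      where
      module ℤSolver = Data.Integer.Solver.+-*-Solver
      one : ∀ {n} → ℤSolver.Polynomial n
      one = ℤSolver.con (+ 1)

  /1-* : ∀ i j → (i ℤ.* j) ℚ./ 1 ≡ (i ℚ./ 1) ℚ.* (j ℚ./ 1)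
  /1-* i j = ℚ.toℚᵘ-injective (begin
    ℚ.toℚᵘ ((i ℤ.* j) ℚ./ 1)                    ≈⟨ toℚᵘ-/1 (i ℤ.* j) ⟩
    mkℚᵘ i 0 ℚᵘ.* mkℚᵘ j 0                      ≈⟨ ℚᵘ.*-cong (toℚᵘ-/1 i) (toℚᵘ-/1 j) ⟨
    ℚ.toℚᵘ (i ℚ./ 1) ℚᵘ.* ℚ.toℚᵘ (j ℚ./ 1)      ≈⟨ ℚ.toℚᵘ-homo-* (i ℚ./ 1) (j ℚ./ 1) ⟨
    ℚ.toℚᵘ ((i ℚ./ 1) ℚ.* (j ℚ./ 1))                ∎)
    where open ℚᵘ.≃-Reasoning

  /1-neg : ∀ i → (ℤ.- i) ℚ./ 1 ≡ ℚ.- (i ℚ./ 1)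
  /1-neg i = ℚ.toℚᵘ-injective (begin
    ℚ.toℚᵘ ((ℤ.- i) ℚ./ 1)      ≈⟨ toℚᵘ-/1 (ℤ.- i) ⟩
    ℚᵘ.- mkℚᵘ i 0               ≈⟨ ℚᵘ.-‿cong (toℚᵘ-/1 i) ⟨
    ℚᵘ.- ℚ.toℚᵘ (i ℚ./ 1)       ≈⟨ ℚ.toℚᵘ-homo‿- (i ℚ./ 1) ⟨
    ℚ.toℚᵘ (ℚ.- (i ℚ./ 1))      ∎)
    where open ℚᵘ.≃-Reasoning

  /1-mono-≤ : ∀ {i j} → i ℤ.≤ j → i ℚ./ 1 ℚ.≤ j ℚ./ 1
  /1-mono-≤ {i} {j} i≤j = ℚ.toℚᵘ-cancel-≤ (begin
    ℚ.toℚᵘ (i ℚ./ 1)    ≃⟨ toℚᵘ-/1 i ⟩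
    mkℚᵘ i 0            ≤⟨ ℚᵘ.*≤* (ℤ.*-monoʳ-≤-nonNeg (+ 1) i≤j) ⟩
    mkℚᵘ j 0            ≃⟨ toℚᵘ-/1 j ⟨
    ℚ.toℚᵘ (j ℚ./ 1)    ∎)
    where open ℚᵘ.≤-Reasoning

  -- A single term far enough out decides which alternative holds.
  dichotomy : ∀ x {ε} → 0ℚ ℚ.< ε →
    Eventually (λ n → ℚ.∣ seq x n ∣ ℚ.≤ ε) ⊎
    (∃ λ δ → 0ℚ ℚ.< δ × Eventually λ n → δ ℚ.≤ ℚ.∣ seq x n ∣)
  dichotomy x {ε} 0<ε =
    -- The threshold is γ = ε/2 and the Cauchy tolerance δ = ε/4: a term below γ keeps the tail
    -- below γ + δ ≤ ε, and one above γ keeps it above γ - δ = δ.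
    let γ , 0<γ , γ+γ≡ε = half 0<ε
        δ , 0<δ , δ+δ≡γ = half 0<γ
        N , close = cauchy x δ 0<δ
    in Sum.map
      (λ xN≤γ → N , λ n N≤n → small γ+γ≡ε 0<δ δ+δ≡γ xN≤γ (close n N N≤n ℕ.≤-refl))
      (λ γ≤xN → δ , 0<δ , N , λ n N≤n → large δ+δ≡γ γ≤xN (close N n ℕ.≤-refl N≤n))
      (ℚ.≤-total ℚ.∣ seq x N ∣ γ)
    where
    open ℚ.≤-Reasoning

    small : ∀ {γ δ p q} → γ ℚ.+ γ ≡ ε → 0ℚ ℚ.< δ → δ ℚ.+ δ ≡ γ →
            ℚ.∣ q ∣ ℚ.≤ γ → ℚ.∣ p ℚ.- q ∣ ℚ.≤ δ → ℚ.∣ p ∣ ℚ.≤ ε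
    small {γ} {δ} {p} {q} γ+γ≡ε 0<δ δ+δ≡γ q≤γ p-q≤δ = begin
      ℚ.∣ p ∣                  ≡⟨ ≡.cong ℚ.∣_∣ (regroup p q) ⟩
      ℚ.∣ q ℚ.+ (p ℚ.- q) ∣    ≤⟨ ∣p+q∣≤ q (p ℚ.- q) γ δ q≤γ p-q≤δ ⟩
      γ ℚ.+ δ                  ≡⟨ ≡.cong (γ ℚ.+_) (ℚ.+-identityʳ δ) ⟨
      γ ℚ.+ (δ ℚ.+ 0ℚ)         ≤⟨ ℚ.+-monoʳ-≤ γ (ℚ.+-monoʳ-≤ δ (ℚ.<⇒≤ 0<δ)) ⟩
      γ ℚ.+ (δ ℚ.+ δ)          ≡⟨ ≡.cong (γ ℚ.+_) δ+δ≡γ ⟩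
      γ ℚ.+ γ                  ≡⟨ γ+γ≡ε ⟩
      ε                        ∎

    large : ∀ {γ δ p q} → δ ℚ.+ δ ≡ γ → γ ℚ.≤ ℚ.∣ q ∣ → ℚ.∣ q ℚ.- p ∣ ℚ.≤ δ → δ ℚ.≤ ℚ.∣ p ∣
    large {γ} {δ} {p} {q} δ+δ≡γ γ≤q q-p≤δ = begin
      δ                          ≡⟨ solve 1 (λ d → (d :+ d) :- d := d) ≡.refl δ ⟨
      (δ ℚ.+ δ) ℚ.- δ            ≡⟨ ≡.cong (ℚ._- δ) δ+δ≡γ ⟩
      γ ℚ.- δ                    ≤⟨ ℚ.+-monoˡ-≤ (ℚ.- δ) γ≤q ⟩
      ℚ.∣ q ∣ ℚ.- δ              ≡⟨ ≡.cong (λ r → ℚ.∣ r ∣ ℚ.- δ) (regroup q p) ⟩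
      ℚ.∣ p ℚ.+ (q ℚ.- p) ∣ ℚ.- δ ≤⟨ ℚ.+-monoˡ-≤ (ℚ.- δ) (∣p+q∣≤ p (q ℚ.- p) ℚ.∣ p ∣ δ ℚ.≤-refl q-p≤δ) ⟩
      (ℚ.∣ p ∣ ℚ.+ δ) ℚ.- δ      ≡⟨ solve 2 (λ a d → (a :+ d) :- d := a) ≡.refl ℚ.∣ p ∣ δ ⟩
      ℚ.∣ p ∣                    ∎

  apart⇒¬null : ∀ {s δ} → 0ℚ ℚ.< δ → Eventually (λ n → δ ℚ.≤ ℚ.∣ s n ∣) → ¬ Null s
  apart⇒¬null {δ = δ} 0<δ apart null = let γ , 0<γ , γ+γ≡δ = half 0<δ in ℚ.<-irrefl ≡.refl (begin-strict
    δ           ≤⟨ eventually-const (eventually-map₂ ℚ.≤-trans apart (null γ 0<γ)) ⟩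
    γ           ≡⟨ ℚ.+-identityʳ γ ⟨
    γ ℚ.+ 0ℚ    <⟨ ℚ.+-monoʳ-< γ 0<γ ⟩
    γ ℚ.+ γ     ≡⟨ γ+γ≡δ ⟩
    δ           ∎)
    where open ℚ.≤-Reasoning

  ≈0⇒null : ∀ {x} → x ≈ 0ℝ → Null (seq x)
  ≈0⇒null {x} = null-cong λ n → ℚ.+-identityʳ (seq x n)

  null⇒≈0 : ∀ {x} → Null (seq x) → x ≈ 0ℝ
  null⇒≈0 {x} = null-cong λ n → ≡.sym (ℚ.+-identityʳ (seq x n))

  -- For each ε, `dichotomy` gives either the required estimate or a tail bounded away from 0; the
  -- latter refutes x ≈ 0, which the hypothesis forbids.
  ≈0-stable : ∀ {x} → ¬ ¬ x ≈ 0ℝ → x ≈ 0ℝ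
  ≈0-stable {x} ¬¬x≈0 = null⇒≈0 {x} λ ε 0<ε → small (dichotomy x 0<ε)
    where
    small : ∀ {ε} → Eventually (λ n → ℚ.∣ seq x n ∣ ℚ.≤ ε) ⊎ _ → Eventually λ n → ℚ.∣ seq x n ∣ ℚ.≤ ε
    small (inj₁ x≤ε)            = x≤ε
    small (inj₂ (δ , 0<δ , apart)) =
      contradiction (λ x≈0 → apart⇒¬null 0<δ apart (≈0⇒null {x} x≈0)) ¬¬x≈0

  -- If `y` were bounded away from 0, then `x` would be small for every ε, as otherwise the product
  -- would be bounded away from 0; hence x ≈ 0, a contradiction.
  cancelˡ : ∀ {x y} → x * y ≈ 0ℝ → ¬ x ≈ 0ℝ → y ≈ 0ℝ
  cancelˡ {x} {y} xy≈0 x≉0 = null⇒≈0 {y} λ ε 0<ε → small-y (dichotomy y 0<ε)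
    where
    apart-* : ∀ {p q δ γ} → 0ℚ ℚ.< δ → 0ℚ ℚ.< γ →
              δ ℚ.≤ ℚ.∣ p ∣ → γ ℚ.≤ ℚ.∣ q ∣ → δ ℚ.* γ ℚ.≤ ℚ.∣ p ℚ.* q ∣
    apart-* {p} {q} {δ} {γ} 0<δ 0<γ δ≤p γ≤q = begin
      δ ℚ.* γ              ≤⟨ ℚ.*-monoʳ-≤-nonNeg γ {{ℚ.nonNegative (ℚ.<⇒≤ 0<γ)}} δ≤p ⟩
      ℚ.∣ p ∣ ℚ.* γ        ≤⟨ ℚ.*-monoˡ-≤-nonNeg ℚ.∣ p ∣ {{ℚ.∣-∣-nonNeg p}} γ≤q ⟩
      ℚ.∣ p ∣ ℚ.* ℚ.∣ q ∣  ≡⟨ ℚ.∣p*q∣≡∣p∣*∣q∣ p q ⟨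
      ℚ.∣ p ℚ.* q ∣        ∎
      where open ℚ.≤-Reasoning

    0<* : ∀ {δ γ} → 0ℚ ℚ.< δ → 0ℚ ℚ.< γ → 0ℚ ℚ.< δ ℚ.* γ
    0<* {δ} {γ} 0<δ 0<γ = ℚ.positive⁻¹ (δ ℚ.* γ)
      {{ℚ.pos*pos⇒pos δ {{ℚ.positive 0<δ}} γ {{ℚ.positive 0<γ}}}}

    small-y : ∀ {ε} → Eventually (λ n → ℚ.∣ seq y n ∣ ℚ.≤ ε) ⊎ _ → Eventually λ n → ℚ.∣ seq y n ∣ ℚ.≤ ε
    small-y (inj₁ y≤ε) = y≤ε
    small-y (inj₂ (γ , 0<γ , y-apart)) =
      contradiction (null⇒≈0 {x} λ ε 0<ε → small-x (dichotomy x 0<ε)) x≉0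
      where
      small-x : ∀ {ε} → Eventually (λ n → ℚ.∣ seq x n ∣ ℚ.≤ ε) ⊎ _ → Eventually λ n → ℚ.∣ seq x n ∣ ℚ.≤ ε
      small-x (inj₁ x≤ε) = x≤ε
      small-x (inj₂ (δ , 0<δ , x-apart)) = contradiction (≈0⇒null {x * y} xy≈0)
        (apart⇒¬null (0<* 0<δ 0<γ)
          (eventually-map₂ (λ {n} → apart-* {seq x n} {seq y n} 0<δ 0<γ) x-apart y-apart))

  -- A sequence representing a nonnegative real may have negative terms; allowing every deficit ε in
  -- the tail makes the notion invariant under `≈`.
  Nonneg : ℝ → Set
  Nonneg x = ∀ ε → 0ℚ ℚ.< ε → Eventually λ n → ℚ.- seq x n ℚ.≤ ε

  termwise⇒Nonneg : ∀ {x} → Eventually (λ n → 0ℚ ℚ.≤ seq x n) → Nonneg x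
  termwise⇒Nonneg 0≤x ε 0<ε =
    eventually-map (λ 0≤xₙ → ℚ.≤-trans (ℚ.neg-antimono-≤ 0≤xₙ) (ℚ.<⇒≤ 0<ε)) 0≤x

  Nonneg-resp : ∀ {x y} → x ≈ y → Nonneg x → Nonneg y
  Nonneg-resp {x} {y} x≈y 0≤x ε 0<ε = let δ , 0<δ , δ+δ≡ε = half 0<ε in eventually-map₂
    (λ {n} -x≤δ x-y≤δ → begin
      ℚ.- seq y n
        ≡⟨ solve 2 (λ x y → :- y := :- x :+ (x :- y)) ≡.refl (seq x n) (seq y n) ⟩
      ℚ.- seq x n ℚ.+ (seq x n ℚ.- seq y n)
        ≤⟨ ℚ.+-mono-≤ -x≤δ (ℚ.≤-trans (p≤∣p∣ (seq x n ℚ.- seq y n)) x-y≤δ) ⟩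
      δ ℚ.+ δ
        ≡⟨ δ+δ≡ε ⟩
      ε ∎)
    (0≤x δ 0<δ) (x≈y δ 0<δ)
    where open ℚ.≤-Reasoning

  Nonneg-+ : ∀ {x y} → Nonneg x → Nonneg y → Nonneg (x + y)
  Nonneg-+ {x} {y} 0≤x 0≤y ε 0<ε = let δ , 0<δ , δ+δ≡ε = half 0<ε in eventually-map₂
    (λ {n} -x≤δ -y≤δ → ≡.subst₂ ℚ._≤_
      (solve 2 (λ x y → :- x :+ :- y := :- (x :+ y)) ≡.refl (seq x n) (seq y n)) δ+δ≡ε
      (ℚ.+-mono-≤ -x≤δ -y≤δ))
    (0≤x δ 0<δ) (0≤y δ 0<δ)

  0≤p*q : ∀ {p q} → 0ℚ ℚ.≤ p → 0ℚ ℚ.≤ q → 0ℚ ℚ.≤ p ℚ.* q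
  0≤p*q {p} {q} 0≤p 0≤q = ℚ.nonNegative⁻¹ (p ℚ.* q)
    {{ℚ.nonNeg*nonNeg⇒nonNeg p {{ℚ.nonNegative 0≤p}} q {{ℚ.nonNegative 0≤q}}}}

  Nonneg-* : ∀ {x y} → Nonneg x → Nonneg y → Nonneg (x * y)
  Nonneg-* {x} {y} 0≤x 0≤y ε 0<ε =
    let B  , 0<B  , x≤B    = bounded x
        B′ , 0<B′ , y≤B′   = bounded y
        δ  , 0<δ  , Bδ≡ε   = quotient 0<B 0<ε
        δ′ , 0<δ′ , B′δ′≡ε = quotient 0<B′ 0<ε
    in eventually-map₂
      (λ {n} (x≤B , -y≤δ) (y≤B′ , -x≤δ′) → estimate (seq x n) (seq y n)
        (λ y≤0 → ≡.subst (ℚ.∣ seq x n ℚ.* seq y n ∣ ℚ.≤_) Bδ≡ε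
          (∣p*q∣≤ (seq x n) (seq y n) B δ x≤B (nonpos⇒small (seq y n) 0<δ y≤0 -y≤δ)))
        (λ x≤0 → ≡.subst₂ ℚ._≤_ (≡.cong ℚ.∣_∣ (ℚ.*-comm (seq y n) (seq x n))) B′δ′≡ε
          (∣p*q∣≤ (seq y n) (seq x n) B′ δ′ y≤B′ (nonpos⇒small (seq x n) 0<δ′ x≤0 -x≤δ′)))
        (ℚ.≤-total 0ℚ (seq x n)) (ℚ.≤-total 0ℚ (seq y n)))
      (eventually-map₂ _,_ x≤B (0≤y δ 0<δ)) (eventually-map₂ _,_ y≤B′ (0≤x δ′ 0<δ′))
    where
    nonpos⇒small : ∀ p {δ} → 0ℚ ℚ.< δ → p ℚ.≤ 0ℚ → ℚ.- p ℚ.≤ δ → ℚ.∣ p ∣ ℚ.≤ δ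
    nonpos⇒small p 0<δ p≤0 -p≤δ = ∣p∣≤ p (ℚ.≤-trans p≤0 (ℚ.<⇒≤ 0<δ)) -p≤δ

    -- Only a negative factor can make the product negative, and such a factor is small.
    estimate : ∀ p q → (q ℚ.≤ 0ℚ → ℚ.∣ p ℚ.* q ∣ ℚ.≤ ε) → (p ℚ.≤ 0ℚ → ℚ.∣ p ℚ.* q ∣ ℚ.≤ ε) →
               0ℚ ℚ.≤ p ⊎ p ℚ.≤ 0ℚ → 0ℚ ℚ.≤ q ⊎ q ℚ.≤ 0ℚ → ℚ.- (p ℚ.* q) ℚ.≤ ε
    estimate p q _ _ (inj₁ 0≤p) (inj₁ 0≤q) =
      ℚ.≤-trans (ℚ.neg-antimono-≤ (0≤p*q 0≤p 0≤q)) (ℚ.<⇒≤ 0<ε)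
    estimate p q q-small _ _ (inj₂ q≤0) = ℚ.≤-trans (-p≤∣p∣ (p ℚ.* q)) (q-small q≤0)
    estimate p q _ p-small (inj₂ p≤0) _ = ℚ.≤-trans (-p≤∣p∣ (p ℚ.* q)) (p-small p≤0)

  Nonneg-square : ∀ x → Nonneg (x * x)
  Nonneg-square x = termwise⇒Nonneg {x * x} (always λ n → 0≤p² (seq x n))
    where
    0≤p² : ∀ p → 0ℚ ℚ.≤ p ℚ.* p
    0≤p² p = Sum.[ (λ 0≤p → 0≤p*q 0≤p 0≤p) , square-of-nonpos ]′ (ℚ.≤-total 0ℚ p)
      where
      square-of-nonpos : p ℚ.≤ 0ℚ → 0ℚ ℚ.≤ p ℚ.* p
      square-of-nonpos p≤0 = ≡.subst (0ℚ ℚ.≤_) (solve 1 (λ p → (:- p) :* (:- p) := p :* p) ≡.refl p)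
        (0≤p*q (ℚ.neg-antimono-≤ p≤0) (ℚ.neg-antimono-≤ p≤0))

  Nonneg-antisym : ∀ {x} → Nonneg x → Nonneg (neg x) → x ≈ 0ℝ
  Nonneg-antisym {x} 0≤x x≤0 = null⇒≈0 {x} λ ε 0<ε → eventually-map₂
    (λ {n} -x≤ε -[-x]≤ε → ∣p∣≤ (seq x n)
      (≡.subst (ℚ._≤ ε) (solve 1 (λ p → :- (:- p) := p) ≡.refl (seq x n)) -[-x]≤ε) -x≤ε)
    (0≤x ε 0<ε) (x≤0 ε 0<ε)

  1≉0 : ¬ fromℕ 1 ≈ 0ℝ
  1≉0 1≈0 = apart⇒¬null {λ _ → 1ℚ} (ℚ.positive⁻¹ 1ℚ) (always λ _ → ℚ.≤-refl {1ℚ}) (≈0⇒null {fromℕ 1} 1≈0)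

  ℝ-orderedDomain : OrderedDomain
  ℝ-orderedDomain = record
    { commutativeRing = ℝ-commutativeRing
    ; ι = fromℤ
    ; ι-+ = λ i j → ≗⇒≋ λ _ → /1-+ i j
    ; ι-* = λ i j → ≗⇒≋ λ _ → /1-* i j
    ; ι-neg = λ i → ≗⇒≋ λ _ → /1-neg i
    ; ι-0 = wrap (≈-refl {0ℝ})
    ; ι-1 = wrap (≈-refl {fromℕ 1})
    ; 1≉0 = 1≉0 ∘ unwrap
    ; ≈0-stable = λ {x} ¬¬x≋0 → wrap (≈0-stable {x} λ x≉0 → ¬¬x≋0 (x≉0 ∘ unwrap))
    ; cancelˡ = λ {x} {y} xy≋0 x≉0 → wrap (cancelˡ {x} {y} (unwrap xy≋0) (x≉0 ∘ wrap))
    ; Nonneg = Nonneg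
    ; Nonneg-resp = λ {x} {y} x≋y → Nonneg-resp {x} {y} (unwrap x≋y)
    ; Nonneg-+ = λ {x} {y} → Nonneg-+ {x} {y}
    ; Nonneg-* = λ {x} {y} → Nonneg-* {x} {y}
    ; Nonneg-square = Nonneg-square
    ; Nonneg-antisym = λ {x} 0≤x x≤0 → wrap (Nonneg-antisym {x} 0≤x x≤0)
    }

  <⇒Nonneg : ∀ {x y} → x < y → Nonneg (y + neg x)
  <⇒Nonneg {x} {y} (ε , 0<ε , x+ε≤y) = termwise⇒Nonneg {y + neg x} (eventually-map
    (λ {n} x+ε≤yₙ → begin
      0ℚ                          ≤⟨ ℚ.<⇒≤ 0<ε ⟩
      ε                           ≡⟨ solve 2 (λ x ε → ε := (x :+ ε) :- x) ≡.refl (seq x n) ε ⟩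
      (seq x n ℚ.+ ε) ℚ.- seq x n ≤⟨ ℚ.+-monoˡ-≤ (ℚ.- seq x n) x+ε≤yₙ ⟩
      seq y n ℚ.- seq x n         ∎) x+ε≤y)
    where open ℚ.≤-Reasoning

  <⇒≉ : ∀ {x y} → x < y → ¬ y ≈ x
  <⇒≉ {x} {y} (ε , 0<ε , x+ε≤y) y≈x = apart⇒¬null 0<ε (eventually-map
    (λ {n} x+ε≤yₙ → begin
      ε                           ≡⟨ solve 2 (λ x ε → ε := (x :+ ε) :- x) ≡.refl (seq x n) ε ⟩
      (seq x n ℚ.+ ε) ℚ.- seq x n ≤⟨ ℚ.+-monoˡ-≤ (ℚ.- seq x n) x+ε≤yₙ ⟩
      seq y n ℚ.- seq x n         ≤⟨ p≤∣p∣ (seq y n ℚ.- seq x n) ⟩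
      ℚ.∣ seq y n ℚ.- seq x n ∣   ∎) x+ε≤y) y≈x
    where open ℚ.≤-Reasoning

  <-fromℕ-≤ : ∀ {x m n} → x < fromℕ m → m ℕ.≤ n → x < fromℕ n
  <-fromℕ-≤ (ε , 0<ε , x+ε≤m) m≤n = ε , 0<ε ,
    eventually-map (λ x+ε≤m → ℚ.≤-trans x+ε≤m (/1-mono-≤ (ℤ.+≤+ m≤n))) x+ε≤m

  fromℕ-≤-< : ∀ {x m n} → m ℕ.≤ n → fromℕ n < x → fromℕ m < x
  fromℕ-≤-< m≤n (ε , 0<ε , n+ε≤x) = ε , 0<ε ,
    eventually-map (ℚ.≤-trans (ℚ.+-monoˡ-≤ ε (/1-mono-≤ (ℤ.+≤+ m≤n)))) n+ε≤x

  fromℕ-mono-< : ∀ {m n} → m ℕ.< n → fromℕ m < fromℕ n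
  fromℕ-mono-< {m} {n} m<n = 1ℚ , ℚ.positive⁻¹ 1ℚ , always λ _ →
    ≡.subst (ℚ._≤ + n ℚ./ 1) (≡.trans (≡.cong (λ k → + k ℚ./ 1) (ℕ.+-comm 1 m)) (/1-+ (+ m) (+ 1)))
      (/1-mono-≤ (ℤ.+≤+ m<n))

  fromℕ-nonneg : ∀ n → Nonneg (fromℕ n)
  fromℕ-nonneg n = termwise⇒Nonneg {fromℕ n} (always λ _ → /1-mono-≤ (ℤ.+≤+ (ℕ.z≤n {n})))

-- Counting colours and distances

module ℕSum = Algebra.Properties.CommutativeMonoid.Sum ℕ.+-0-commutativeMonoid

𝟙 : ∀ {P : Set} → Dec P → ℕ
𝟙 P? = if does P? then 1 else 0

∑ᴺ-mono : ∀ {n} {f g : Vector ℕ n} → (∀ i → f i ℕ.≤ g i) → ∑ᴺ f ℕ.≤ ∑ᴺ g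
∑ᴺ-mono {zero}  f≤g = z≤n
∑ᴺ-mono {suc n} f≤g = ℕ.+-mono-≤ (f≤g zero) (∑ᴺ-mono (f≤g ∘ suc))

∑ᴺ-const : ∀ n k → ∑ᴺ {n} (λ _ → k) ≡ n ℕ.* k
∑ᴺ-const zero    k = ≡.refl
∑ᴺ-const (suc n) k = ≡.cong (k ℕ.+_) (∑ᴺ-const n k)

∑ᴺ-𝟙-≟ : ∀ {n} (i : Fin n) → ∑ᴺ (λ j → 𝟙 (i Fin.≟ j)) ≡ 1
∑ᴺ-𝟙-≟ {suc n} zero    = ≡.cong suc (≡.trans (∑ᴺ-const n 0) (ℕ.*-zeroʳ n))
∑ᴺ-𝟙-≟ {suc n} (suc i) = ∑ᴺ-𝟙-≟ i

∑ᴺ-𝟙-complement : ∀ {A : Set} {P : A → Set} (P? : Decidable P) {n} (f : Fin n → A) →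
  ∑ᴺ (λ i → 𝟙 (P? (f i))) ℕ.+ length (filter (¬? ∘ P?) (tabulate f)) ≡ n
∑ᴺ-𝟙-complement P? {zero}  f = ≡.refl
∑ᴺ-𝟙-complement P? {suc n} f with does (P? (f zero))
... | true  = ≡.cong suc (∑ᴺ-𝟙-complement P? (f ∘ suc))
... | false = ≡.trans (ℕ.+-suc _ _) (≡.cong suc (∑ᴺ-𝟙-complement P? (f ∘ suc)))

-- If every fibre had fewer than ⌈n/χ⌉ elements, summing count + 1 ≤ ⌈n/χ⌉ over the colours would
-- give n + χ ≤ χ⌈n/χ⌉, whereas the rounding gives χ⌈n/χ⌉ ≤ n + χ - 1.
large-fibre : ∀ {n χ} (c : Fin n → Fin χ) → 1 ℕ.≤ n →
              ∃ λ a → ⌈ n / χ ⌉ ℕ.≤ ∑ᴺ (λ u → 𝟙 (c u Fin.≟ a))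
large-fibre {suc _} {zero} c _ with () ← c zero
large-fibre {n} {χ@(suc k)} c _ with Fin.any? (λ a → ⌈ n / χ ⌉ ℕ.≤? ∑ᴺ (λ u → 𝟙 (c u Fin.≟ a)))
... | yes large = large
... | no  small = ⊥-elim (ℕ.<-irrefl ≡.refl (begin-strict
  n ℕ.+ k                         <⟨ ℕ.≤-reflexive (≡.cong suc (ℕ.+-comm n k)) ⟩
  χ ℕ.+ n                         ≡⟨ ≡.cong₂ ℕ._+_ (≡.trans (∑ᴺ-const χ 1) (ℕ.*-identityʳ χ)) count-total ⟨
  ∑ᴺ {χ} (λ _ → 1) ℕ.+ ∑ᴺ count   ≡⟨ ℕSum.∑-distrib-+ {χ} (λ _ → 1) count ⟨
  ∑ᴺ (λ a → suc (count a))        ≤⟨ ∑ᴺ-mono (λ a → ℕ.≰⇒> (λ large → small (a , large))) ⟩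
  ∑ᴺ {χ} (λ _ → ⌈ n / χ ⌉)        ≡⟨ ∑ᴺ-const χ ⌈ n / χ ⌉ ⟩
  χ ℕ.* ⌈ n / χ ⌉                 ≡⟨ ℕ.*-comm χ ⌈ n / χ ⌉ ⟩
  (n ℕ.+ k) ℕ./ χ ℕ.* χ           ≤⟨ ℕ.m/n*n≤m (n ℕ.+ k) χ ⟩
  n ℕ.+ k                         ∎))
  where
  open ℕ.≤-Reasoning
  count : Fin χ → ℕ
  count a = ∑ᴺ λ u → 𝟙 (c u Fin.≟ a)

  count-total : ∑ᴺ count ≡ n
  count-total = ≡.trans (ℕSum.∑-comm (λ a u → 𝟙 (c u Fin.≟ a)))
    (≡.trans (ℕSum.sum-cong-≗ (λ u → ∑ᴺ-𝟙-≟ (c u)))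
      (≡.trans (∑ᴺ-const n 1) (ℕ.*-identityʳ n)))

-- `t` is the slack: it is a difference of naturals for the inequality and 0 for equality.
bound-decomposition : ∀ n χ C {k t} → ⌈ n / χ ⌉ ℕ.+ C ℕ.+ (k ℕ.+ t) ≡ suc n →
                      bound n χ C ≡ + (k ℕ.+ t)
bound-decomposition n χ C {k} {t} eq = begin
  + n ℤ.- + q ℤ.- + C ℤ.+ + 1
    ≡⟨ solve 3 (λ n q c → n :- q :- c :+ con (+ 1) := (con (+ 1) :+ n) :- (q :+ c)) ≡.refl (+ n) (+ q) (+ C) ⟩
  + suc n ℤ.- + (q ℕ.+ C)
    ≡⟨ ≡.cong (λ m → + m ℤ.- + (q ℕ.+ C)) eq ⟨
  + (q ℕ.+ C) ℤ.+ + (k ℕ.+ t) ℤ.- + (q ℕ.+ C)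
    ≡⟨ solve 2 (λ a b → a :+ b :- a := b) ≡.refl (+ (q ℕ.+ C)) (+ (k ℕ.+ t)) ⟩
  + (k ℕ.+ t) ∎
  where
  open ≡.≡-Reasoning
  open Data.Integer.Solver.+-*-Solver
  q = ⌈ n / χ ⌉

bound-≥ : ∀ n χ C {k} → ⌈ n / χ ⌉ ℕ.+ C ℕ.+ k ℕ.≤ suc n → + k ℤ.≤ bound n χ C
bound-≥ n χ C {k} q+C+k≤1+n = ≡.subst (+ k ℤ.≤_)
  (≡.sym (bound-decomposition n χ C {k} {t}
    (≡.trans (≡.sym (ℕ.+-assoc (⌈ n / χ ⌉ ℕ.+ C) k t)) (ℕ.m+[n∸m]≡n q+C+k≤1+n))))
  (ℤ.+≤+ (ℕ.m≤m+n k t))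
  where
  t = suc n ℕ.∸ (⌈ n / χ ⌉ ℕ.+ C ℕ.+ k)

module _ {n} (G : Graph n) where

  walk-snoc : ∀ {u v w k} → Walk G u v k → Adj G v w → Walk G u w (suc k)
  walk-snoc []      b = b ∷ []
  walk-snoc (a ∷ p) b = a ∷ walk-snoc p b

  walk-reverse : ∀ {u v k} → Walk G u v k → Walk G v u k
  walk-reverse []      = []
  walk-reverse (a ∷ p) = walk-snoc (walk-reverse p) (symm G a)

  module _ (conn : Connected G) where

    dist-walk : ∀ u v → Walk G u v (dist G conn u v)
    dist-walk u v = proj₁ (proj₂ (distance G conn u v))

    dist-≤ : ∀ {u v k} → Walk G u v k → dist G conn u v ℕ.≤ k
    dist-≤ {u} {v} {k} p = proj₂ (proj₂ (distance G conn u v)) k p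

    dist-sym : ∀ u v → dist G conn u v ≡ dist G conn v u
    dist-sym u v = ℕ.≤-antisym
      (dist-≤ (walk-reverse (dist-walk v u))) (dist-≤ (walk-reverse (dist-walk u v)))

    dist-positive : ∀ {u v} → u ≢ v → 1 ℕ.≤ dist G conn u v
    dist-positive {u} {v} u≢v with dist G conn u v | dist-walk u v
    ... | zero  | []  = contradiction ≡.refl u≢v
    ... | suc _ | _   = s≤s z≤n

    dist-nonadjacent : ∀ {u v} → u ≢ v → ¬ Adj G u v → 2 ℕ.≤ dist G conn u v
    dist-nonadjacent {u} {v} u≢v ¬adj with dist G conn u v | dist-walk u v
    ... | zero        | []      = contradiction ≡.refl u≢v
    ... | suc zero    | a ∷ []  = contradiction a ¬adj
    ... | suc (suc _) | _       = s≤s (s≤s z≤n)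

    dist-adjacent : ∀ {u v} → u ≢ v → Adj G u v → dist G conn u v ≡ 1
    dist-adjacent u≢v a = ℕ.≤-antisym (dist-≤ (a ∷ [])) (dist-positive u≢v)

-- Distance Laplacian spectra

⌈/⌉-positive : ∀ {n χ} → 1 ℕ.≤ n → (Fin n → Fin χ) → 0 ℕ.< ⌈ n / χ ⌉
⌈/⌉-positive {suc n} {zero}  _ c = ⊥-elim (Fin.¬Fin0 (c zero))
⌈/⌉-positive {suc n} {suc k} _ _ = ℕ.m≥n⇒m/n>0 (s≤s (ℕ.m≤n+m k n))

module GraphSpectrum (O : OrderedDomain) where

  open OrderedDomain O hiding (zero)
  open OrderedDomainSolver O using (solve; _:+_; _:*_; _:-_; _:=_)
  open Spectral O
  open Laplacian O
  open EigenvalueCount O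
  open Algebra.Properties.Semiring.Sum semiring
  open Relation.Binary.Reasoning.Setoid setoid

  fromℕ : ℕ → Carrier
  fromℕ n = ι (+ n)

  fromℕ-+ : ∀ m n → fromℕ (m ℕ.+ n) ≈ fromℕ m + fromℕ n
  fromℕ-+ m n = ι-+ (+ m) (+ n)

  fromℕ-* : ∀ m n → fromℕ (m ℕ.* n) ≈ fromℕ m * fromℕ n
  fromℕ-* m n = trans (reflexive (≡.cong ι (ℤ.pos-* m n))) (ι-* (+ m) (+ n))

  fromℕ-∑ᴺ : ∀ {n} (f : Vector ℕ n) → fromℕ (∑ᴺ f) ≈ sum (λ i → fromℕ (f i))
  fromℕ-∑ᴺ {zero}  f = ι-0
  fromℕ-∑ᴺ {suc n} f = trans (fromℕ-+ (f zero) (∑ᴺ (f ∘ suc))) (+-congˡ (fromℕ-∑ᴺ (f ∘ suc)))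

  fromℕ-size : ∀ n → fromℕ n ≈ size n
  fromℕ-size n = trans
    (reflexive (≡.cong fromℕ (≡.sym (≡.trans (∑ᴺ-const n 1) (ℕ.*-identityʳ n)))))
    (trans (fromℕ-∑ᴺ {n} (λ _ → 1)) (sum-cong-≋ {n} λ _ → ι-1))

  fromℕ-nonneg : ∀ n → Nonneg (fromℕ n)
  fromℕ-nonneg n = Nonneg-resp (sym (fromℕ-size n))
    (Nonneg-sum {n} λ _ → Nonneg-resp (*-identityˡ 1#) (Nonneg-square 1#))

  fromℕ-mono : ∀ {m n} → m ℕ.≤ n → Nonneg (fromℕ n - fromℕ m)
  fromℕ-mono {m} {n} m≤n = Nonneg-resp (begin
    fromℕ (n ℕ.∸ m)
      ≈⟨ solve 2 (λ a b → b := (a :+ b) :- a) refl (fromℕ m) (fromℕ (n ℕ.∸ m)) ⟩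
    (fromℕ m + fromℕ (n ℕ.∸ m)) - fromℕ m
      ≈⟨ +-congʳ (fromℕ-+ m (n ℕ.∸ m)) ⟨
    fromℕ (m ℕ.+ (n ℕ.∸ m)) - fromℕ m
      ≡⟨ ≡.cong (λ k → fromℕ k - fromℕ m) (ℕ.m+[n∸m]≡n m≤n) ⟩
    fromℕ n - fromℕ m ∎) (fromℕ-nonneg (n ℕ.∸ m))

  -- A record keeps `A`, `a` and `x` recoverable by unification, which the bare family of equations
  -- would not; likewise for `Independent`.
  record Eigen {n} (A : Fin n → Fin n → Carrier) (a : Carrier) (x : Vector Carrier n) : Set where
    constructor mkEigen
    field eigen-eq : ∀ u → sum (λ v → A u v * x v) ≈ a * x u

  record Independent {n k} (x : Vector (Vector Carrier n) k) : Set where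
    constructor mkIndependent
    field coefficients≈0 : ∀ (c : Vector Carrier k) →
            (∀ u → sum (λ j → c j * x j u) ≈ 0#) → ∀ j → c j ≈ 0#

  open Eigen public
  open Independent public

  module _ {n} (G : Graph n) (conn : Connected G) where

    weight : Fin n → Fin n → Carrier
    weight u v = fromℕ (dist G conn u v)

    weight-sym : ∀ u v → weight u v ≈ weight v u
    weight-sym u v = reflexive (≡.cong fromℕ (dist-sym G conn u v))

    open Weighted weight

    -- With `ι = fromℤ` this is definitionally an entry of `distanceLaplacian`, so over the reals
    -- every hypothesis `A≡entry` is met by `≡.refl`.
    entry : Fin n → Fin n → Carrier
    entry u v = ι ((if does (u Fin.≟ v) then + transmission G conn u else + 0) ℤ.- + dist G conn u v)

    entry-laplacian : ∀ {A : Fin n → Fin n → Carrier} → (∀ u v → A u v ≡ entry u v) →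
      ∀ (x : Vector Carrier n) u → sum (λ v → A u v * x v) ≈ laplacian x u
    entry-laplacian {A} A≡entry x u = begin
      sum (λ v → A u v * x v)
        ≈⟨ sum-cong-≋ (λ v → *-congʳ (reflexive (A≡entry u v))) ⟩
      sum (λ v → entry u v * x v)
        ≈⟨ sum-cong-≋ (λ v → trans
             (*-congʳ (trans (ι-+ (diagonal v) (ℤ.- + dist G conn u v))
               (+-congˡ (ι-neg (+ dist G conn u v)))))
             (solve 3 (λ a d x → (a :- d) :* x := a :* x :- d :* x)
               refl (ι (diagonal v)) (weight u v) (x v))) ⟩
      sum (λ v → ι (diagonal v) * x v - weight u v * x v)
        ≈⟨ sum-minus (λ v → ι (diagonal v) * x v) (λ v → weight u v * x v) ⟩
      sum (λ v → ι (diagonal v) * x v) - sum (λ v → weight u v * x v)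
        ≈⟨ +-congʳ (sum-single (λ v → ι (diagonal v) * x v) u λ v v≢u →
             trans (*-congʳ (trans (reflexive (≡.cong (λ b → ι (if b then + transmission G conn u else + 0))
               (dec-false (u Fin.≟ v) (v≢u ∘ ≡.sym)))) ι-0)) (zeroˡ (x v))) ⟩
      ι (diagonal u) * x u - sum (λ v → weight u v * x v)
        -- `transmission` sums distances towards `u`; symmetry turns this into the row sum.
        ≈⟨ +-congʳ (*-congʳ (trans
             (reflexive (≡.cong (λ b → ι (if b then + transmission G conn u else + 0))
               (dec-true (u Fin.≟ u) ≡.refl)))
             (trans (fromℕ-∑ᴺ (λ v → dist G conn v u)) (sum-cong-≋ λ v → weight-sym v u)))) ⟩
      sum (λ v → weight u v) * x u - sum (λ v → weight u v * x v)
        ≈⟨ +-congʳ (*-distribʳ-sum (x u) (λ v → weight u v)) ⟩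
      sum (λ v → weight u v * x u) - sum (λ v → weight u v * x v)
        ≈⟨ sum-minus (λ v → weight u v * x u) (λ v → weight u v * x v) ⟨
      sum (λ v → weight u v * x u - weight u v * x v)
        ≈⟨ sum-cong-≋ (λ v → solve 3 (λ d x y → d :* x :- d :* y := d :* (x :- y))
             refl (weight u v) (x u) (x v)) ⟩
      laplacian x u ∎
      where
      diagonal : Fin n → ℤ
      diagonal v = if does (u Fin.≟ v) then + transmission G conn u else + 0

    module _ {χ} (c : Fin n → Fin χ)
             (proper : ∀ u v → Adj G u v → c u ≢ c v) (a : Fin χ) where

      colour-dominates : ∀ u v → u ≢ v →
        Nonneg (weight u v - (1# + fromℕ (𝟙 (c u Fin.≟ a)) * fromℕ (𝟙 (c v Fin.≟ a))))
      colour-dominates u v u≢v = Nonneg-resp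
        (+-congˡ (-‿cong (trans (fromℕ-+ 1 _) (+-cong ι-1 (fromℕ-* (𝟙 (c u Fin.≟ a)) (𝟙 (c v Fin.≟ a)))))))
        (fromℕ-mono {1 ℕ.+ 𝟙 (c u Fin.≟ a) ℕ.* 𝟙 (c v Fin.≟ a)} far)
        where
        far : 1 ℕ.+ 𝟙 (c u Fin.≟ a) ℕ.* 𝟙 (c v Fin.≟ a) ℕ.≤ dist G conn u v
        far with c u Fin.≟ a | c v Fin.≟ a
        ... | no _ | _ = dist-positive G conn u≢v
        ... | yes _ | no _ = dist-positive G conn u≢v
        ... | yes cu≡a | yes cv≡a = dist-nonadjacent G conn u≢v
          λ adj → proper u v adj (≡.trans cu≡a (≡.sym cv≡a))

      colour-supported : ∀ (x : Vector Carrier n) →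
        All (λ u → x u ≈ 0#) (filter (λ u → ¬? (c u Fin.≟ a)) (allFin n)) →
        ∀ u → fromℕ (𝟙 (c u Fin.≟ a)) * x u ≈ x u
      colour-supported x vanishes u with c u Fin.≟ a
      ... | yes _ = trans (*-congʳ ι-1) (*-identityˡ (x u))
      ... | no cu≢a = trans (trans (*-congʳ ι-0) (zeroˡ (x u))) (sym (All.lookup vanishes
        (∈-filter⁺ (λ u → ¬? (c u Fin.≟ a)) (∈-allFin u) cu≢a)))

    module _ {χ} (c : Fin n → Fin χ) (proper : ∀ u v → Adj G u v → c u ≢ c v)
             {C} (components : ComponentCount (complement G) C) (1≤n : 1 ℕ.≤ n)
             {r} (value : Vector Carrier r) (mult : Vector ℕ r)
             (x : ∀ i → Vector (Vector Carrier n) (mult i))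
             {A : Fin n → Fin n → Carrier} (A≡entry : ∀ u v → A u v ≡ entry u v)
             (eigen : ∀ i j → Eigen A (value i) (x i j))
             (independent : ∀ i → Independent (x i))
             (distinct : ∀ i j → i ≢ j → ¬ value i ≈ value j)
             (value≉0 : ∀ i → ¬ value i ≈ 0#)
             (value≉n : ∀ i → ¬ value i ≈ fromℕ n)
             -- Stated for every larger `m` because it is applied at n + p, and the size p of the
             -- chosen colour class is fixed only later.
             (below : ∀ i m → n ℕ.+ ⌈ n / χ ⌉ ℕ.≤ m → Nonneg (fromℕ m - value i))
             (below≉ : ∀ i m → n ℕ.+ ⌈ n / χ ⌉ ℕ.≤ m → ¬ fromℕ m ≈ value i)
             where

      private
        a : Fin χ
        a = proj₁ (large-fibre c 1≤n)

        outside : List (Fin n)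
        outside = filter (λ u → ¬? (c u Fin.≟ a)) (allFin n)

        p : ℕ
        p = ∑ᴺ λ u → 𝟙 (c u Fin.≟ a)

        q≤p : ⌈ n / χ ⌉ ℕ.≤ p
        q≤p = proj₂ (large-fibre c 1≤n)

        n+q≤n+p : n ℕ.+ ⌈ n / χ ⌉ ℕ.≤ n ℕ.+ p
        n+q≤n+p = ℕ.+-monoʳ-≤ n q≤p

        ∑s : fromℕ p ≈ sum (λ u → fromℕ (𝟙 (c u Fin.≟ a)))
        ∑s = fromℕ-∑ᴺ (λ u → 𝟙 (c u Fin.≟ a))

        0<p : 0 ℕ.< p
        0<p = ℕ.≤-trans (⌈/⌉-positive 1≤n c) q≤p

        fromℕ≉0 : ∀ {m} → 0 ℕ.< m → ¬ fromℕ m ≈ 0#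
        fromℕ≉0 {suc m} _ m≈0 = 1≉0 (trans (sym ι-1)
          (Nonneg+Nonneg≈0 (fromℕ-nonneg 1) (fromℕ-nonneg m) (trans (sym (fromℕ-+ 1 m)) m≈0)))

        comp = proj₁ components

        -- Distinct vertices not adjacent in `G` are adjacent in the complement and hence share a
        -- component.
        across : ∀ u v → comp u ≢ comp v → weight u v ≈ 1#
        across u v cu≢cv = trans (reflexive (≡.cong fromℕ (dist-adjacent G conn u≢v
          (decidable-stable (adj? G u v) λ ¬adj →
            cu≢cv (Equivalence.from (proj₂ (proj₂ components) u v) (1 , (u≢v , ¬adj) ∷ [])))))) ι-1
          where
          u≢v : u ≢ v
          u≢v u≡v = cu≢cv (≡.cong comp u≡v)

        top : fromℕ (n ℕ.+ p) ≈ size n + sum (λ u → fromℕ (𝟙 (c u Fin.≟ a)))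
        top = trans (fromℕ-+ n p) (+-cong (fromℕ-size n) ∑s)

        count : C ℕ.+ ∑ᴺ mult ℕ.≤ suc (length outside)
        count = eigenvalue-count weight weight-sym (λ u → fromℕ (𝟙 (c u Fin.≟ a))) outside
          (colour-supported c proper a)
          (colour-dominates c proper a)
          (Nonneg-resp ∑s (fromℕ-nonneg p))
          (λ ∑s≈0 → fromℕ≉0 0<p (trans ∑s ∑s≈0))
          comp (proj₁ (proj₂ components)) across value mult x
          (λ i j u → trans (sym (entry-laplacian A≡entry (x i j) u)) (eigen-eq (eigen i j) u))
          (λ i → coefficients≈0 (independent i)) distinct value≉0
          (λ i value≈n → value≉n i (trans value≈n (sym (fromℕ-size n))))
          (λ i → Nonneg-resp (+-congʳ top) (below i (n ℕ.+ p) n+q≤n+p))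
          (λ i M≈value → below≉ i (n ℕ.+ p) n+q≤n+p (trans top M≈value))

      multiplicities-bounded : ⌈ n / χ ⌉ ℕ.+ C ℕ.+ ∑ᴺ mult ℕ.≤ suc n
      multiplicities-bounded = ≤.begin
        ⌈ n / χ ⌉ ℕ.+ C ℕ.+ ∑ᴺ mult     ≤.≡⟨ ℕ.+-assoc ⌈ n / χ ⌉ C (∑ᴺ mult) ⟩
        ⌈ n / χ ⌉ ℕ.+ (C ℕ.+ ∑ᴺ mult)   ≤.≤⟨ ℕ.+-mono-≤ q≤p count ⟩
        p ℕ.+ suc (length outside)      ≤.≡⟨ ℕ.+-suc p (length outside) ⟩
        suc (p ℕ.+ length outside)      ≤.≡⟨ ≡.cong suc (∑ᴺ-𝟙-complement (λ u → c u Fin.≟ a) (λ u → u)) ⟩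
        suc n                           ≤.∎
        where module ≤ = ℕ.≤-Reasoning

-- Eigenvectors on one side of a complete bipartite graph

module BipartiteSpectrum (O : OrderedDomain) (a t : ℕ) where

  open OrderedDomain O hiding (zero)
  open Spectral O
  open Laplacian O
  open EigenvalueCount O
  open GraphSpectrum O
  open Algebra.Properties.Semiring.Sum semiring
  open Relation.Binary.Reasoning.Setoid setoid

  Side : Set
  Side = Fin a ⊎ Fin (suc t)

  -- These are the t differences e_{j+1} - e_0 on the second side, a basis of the vectors of sum
  -- zero supported there.
  onSide : Fin t → Side → Carrier
  onSide j (inj₁ _)       = 0#
  onSide j (inj₂ zero)    = - 1#
  onSide j (inj₂ (suc i)) = indicator i j

  member : Side → Carrier
  member (inj₁ _) = 0#
  member (inj₂ _) = 1#

  side : Side → Fin 2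
  side (inj₁ _) = zero
  side (inj₂ _) = suc zero

  difference : Fin t → Vector Carrier (a ℕ.+ suc t)
  difference j u = onSide j (splitAt a u)

  side-sum : ∀ (f : Side → Carrier) → sum (λ u → f (splitAt a u)) ≈
             sum (λ i → f (inj₁ i)) + sum (λ i → f (inj₂ i))
  side-sum f = trans (sum-↑ a (λ u → f (splitAt a u))) (+-cong
    (sum-cong-≋ λ i → reflexive (≡.cong f (Fin.splitAt-↑ˡ a i (suc t))))
    (sum-cong-≋ λ i → reflexive (≡.cong f (Fin.splitAt-↑ʳ a (suc t) i))))

  indicator-sym : ∀ {n} (i j : Fin n) → indicator i j ≈ indicator j i
  indicator-sym i j with i Fin.≟ j
  ... | yes ≡.refl = reflexive (≡.cong (if_then 1# else 0#) (≡.sym (dec-true (i Fin.≟ i) ≡.refl)))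
  ... | no i≢j = reflexive (≡.cong (if_then 1# else 0#) (≡.sym (dec-false (j Fin.≟ i) (i≢j ∘ ≡.sym))))

  sum-difference : ∀ j → sum (difference j) ≈ 0#
  sum-difference j = begin
    sum (difference j)
      ≈⟨ side-sum (onSide j) ⟩
    sum {a} (λ _ → 0#) + (- 1# + sum (λ i → indicator i j))
      ≈⟨ +-cong (sum-zero {a} λ _ → refl) (+-congˡ (trans
           (sum-cong-≋ λ i → trans (indicator-sym i j) (sym (*-identityˡ (indicator j i))))
           (indicator-∙ (λ _ → 1#) j))) ⟩
    0# + (- 1# + 1#)
      ≈⟨ +-identityˡ _ ⟩
    - 1# + 1#
      ≈⟨ -‿inverseˡ 1# ⟩
    0# ∎

  sum-member : sum (λ u → member (splitAt a u)) ≈ size (suc t)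
  sum-member = trans (side-sum member)
    (trans (+-congʳ (sum-zero {a} λ _ → refl)) (+-identityˡ (size (suc t))))

  member-supported : ∀ j p → member p * onSide j p ≈ onSide j p
  member-supported j (inj₁ _) = zeroˡ 0#
  member-supported j (inj₂ i) = *-identityˡ (onSide j (inj₂ i))

  difference-independent : Independent difference
  difference-independent = mkIndependent λ c vanishes i → begin
    c i
      ≈⟨ indicator-∙ c i ⟨
    sum (λ j → c j * indicator i j)
      ≡⟨ ≡.cong (λ p → sum λ j → c j * onSide j p) (Fin.splitAt-↑ʳ a (suc t) (suc i)) ⟨
    sum (λ j → c j * difference j (a ↑ʳ suc i))
      ≈⟨ vanishes (a ↑ʳ suc i) ⟩
    0# ∎

  module _ (G : Graph (a ℕ.+ suc t)) (conn : Connected G)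
           (dist-same : ∀ u v → u ≢ v → side (splitAt a u) ≡ side (splitAt a v) → dist G conn u v ≡ 2)
           (dist-across : ∀ u v → side (splitAt a u) ≢ side (splitAt a v) → dist G conn u v ≡ 1)
           where

    private
      -- Distances equal 1 + s(u)s(v), with s = `member`, except inside the first side, where they
      -- are 2 instead of 1; there both entries of the vector vanish.
      weights : ∀ j p q {w} → (side p ≡ side q → w ≡ 2) → (side p ≢ side q → w ≡ 1) →
        fromℕ w * (onSide j p - onSide j q) ≈
        (1# + member p * member q) * (onSide j p - onSide j q)
      weights j (inj₁ _) (inj₁ _) _ _ = trans (*-congˡ (-‿inverseʳ 0#))
        (trans (zeroʳ _) (sym (trans (*-congˡ (-‿inverseʳ 0#)) (zeroʳ _))))
      weights j (inj₁ _) (inj₂ _) _ across = *-congʳ (trans (reflexive (≡.cong fromℕ (across λ ())))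
        (trans ι-1 (sym (trans (+-congˡ (zeroˡ 1#)) (+-identityʳ 1#)))))
      weights j (inj₂ _) (inj₁ _) _ across = *-congʳ (trans (reflexive (≡.cong fromℕ (across λ ())))
        (trans ι-1 (sym (trans (+-congˡ (zeroʳ 1#)) (+-identityʳ 1#)))))
      weights j (inj₂ _) (inj₂ _) same _ = *-congʳ (trans (reflexive (≡.cong fromℕ (same ≡.refl)))
        (trans (fromℕ-+ 1 1) (+-cong ι-1 (trans ι-1 (sym (*-identityˡ 1#))))))

      weights′ : ∀ j u v → weight G conn u v * (difference j u - difference j v) ≈
        (1# + member (splitAt a u) * member (splitAt a v)) * (difference j u - difference j v)
      weights′ j u v with u Fin.≟ v
      ... | yes ≡.refl = trans (*-congˡ (-‿inverseʳ (difference j u)))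
        (trans (zeroʳ _) (sym (trans (*-congˡ (-‿inverseʳ (difference j u))) (zeroʳ _))))
      ... | no u≢v = weights j (splitAt a u) (splitAt a v) (dist-same u v u≢v) (dist-across u v)

    difference-eigen : ∀ {A : Fin (a ℕ.+ suc t) → Fin (a ℕ.+ suc t) → Carrier} →
      (∀ u v → A u v ≡ entry G conn u v) →
      ∀ j → Eigen A (fromℕ ((a ℕ.+ suc t) ℕ.+ suc t)) (difference j)
    difference-eigen {A} A≡entry j = mkEigen λ u → begin
      sum (λ v → A u v * difference j v)
        ≈⟨ entry-laplacian G conn A≡entry (difference j) u ⟩
      Weighted.laplacian (weight G conn) (difference j) u
        ≈⟨ Weighted.supported-eigenvector (weight G conn) (λ u → member (splitAt a u)) (difference j)
             (weights′ j) (λ v → member-supported j (splitAt a v)) (sum-difference j) u ⟩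
      (size (a ℕ.+ suc t) + sum (λ v → member (splitAt a v))) * difference j u
        ≈⟨ *-congʳ (sym (trans (fromℕ-+ (a ℕ.+ suc t) (suc t))
             (+-cong (fromℕ-size (a ℕ.+ suc t)) (trans (fromℕ-size (suc t)) (sym sum-member))))) ⟩
      fromℕ ((a ℕ.+ suc t) ℕ.+ suc t) * difference j u ∎

-- The upper bound

private module GS = GraphSpectrum Real.ℝ-orderedDomain

open Defs using (fromℕ; 0ℝ; _<_)

module _ {n} (A : Matrix n) {a : ℝ} {x : Vector ℝ n} where

  InEigenspace⇒Eigen : InEigenspace A a x → GS.Eigen A a x
  InEigenspace⇒Eigen eigen = GS.mkEigen λ u → Real.wrap {∑ λ v → A u v Defs.* x v} {a Defs.* x u} (eigen u)

  Eigen⇒InEigenspace : GS.Eigen A a x → InEigenspace A a x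
  Eigen⇒InEigenspace eigen u = Real.unwrap {∑ λ v → A u v Defs.* x v} {a Defs.* x u} (GS.eigen-eq eigen u)

module _ {n k} (x : Vector (Vector ℝ n) k) where

  LinearlyIndependent⇒Independent : LinearlyIndependent x → GS.Independent x
  LinearlyIndependent⇒Independent independent = GS.mkIndependent λ c vanishes j → Real.wrap {c j} {0ℝ}
    (independent c (λ u → Real.unwrap {∑ λ j → c j Defs.* x j u} {0ℝ} (vanishes u)) j)

  Independent⇒LinearlyIndependent : GS.Independent x → LinearlyIndependent x
  Independent⇒LinearlyIndependent independent c vanishes j = Real.unwrap {c j} {0ℝ}
    (GS.coefficients≈0 independent c (λ u → Real.wrap {∑ λ j → c j Defs.* x j u} {0ℝ} (vanishes u)) j)

upper-bound : ∀ n (G : Graph n) (conn : Connected G) → ¬ (G ≅ K n) →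
  ∀ χ → IsChromaticNumber G χ →
  ∀ C → ComponentCount (complement G) C →
  ∀ k → EigenvaluesInAtLeast (distanceLaplacian G conn) (window n χ) k →
  + k ℤ.≤ bound n χ C
-- The graph without vertices is `K 0`; a colour class as required exists only when there is a
-- vertex.
upper-bound zero G conn G≇K _ _ _ _ _ _ =
  contradiction (↔-id _ , λ u v → ⊥-elim (Fin.¬Fin0 u)) G≇K
upper-bound n@(suc _) G conn _ χ ((c , proper) , _) C components k
            (r , value , mult , distinct , in-window , multiplicity , ≡.refl) =
  bound-≥ n χ C (GraphSpectrum.multiplicities-bounded Real.ℝ-orderedDomain G conn c proper
    components (s≤s z≤n) value mult
    (λ i → proj₁ (multiplicity i))
    {distanceLaplacian G conn} (λ u v → ≡.refl)
    (λ i j → InEigenspace⇒Eigen (distanceLaplacian G conn) {value i} {proj₁ (multiplicity i) j}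
      (proj₁ (proj₂ (multiplicity i)) j))
    (λ i → LinearlyIndependent⇒Independent (proj₁ (multiplicity i)) (proj₂ (proj₂ (multiplicity i))))
    (λ i j i≢j value≈ → distinct i j i≢j (Real.unwrap value≈))
    (λ i value≈0 → Real.<⇒≉ {0ℝ} {value i}
      (Real.fromℕ-≤-< {value i} {0} {n} z≤n (proj₁ (in-window i))) (Real.unwrap value≈0))
    (λ i value≈n → Real.<⇒≉ {fromℕ n} {value i} (proj₁ (in-window i)) (Real.unwrap value≈n))
    (λ i m n+q≤m → Real.<⇒Nonneg {value i} {fromℕ m} (value<m i m n+q≤m))
    (λ i m n+q≤m m≈value → Real.<⇒≉ {value i} {fromℕ m} (value<m i m n+q≤m) (Real.unwrap m≈value)))
  where
  value<m : ∀ i m → n ℕ.+ ⌈ n / χ ⌉ ℕ.≤ m → value i < fromℕ m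
  value<m i m = Real.<-fromℕ-≤ {value i} {n ℕ.+ ⌈ n / χ ⌉} {m} (proj₂ (in-window i))

single-eigenvalue : ∀ {n t} (A : Matrix n) (I : ℝ → Set) (a : ℝ) (x : Vector (Vector ℝ n) t) →
  I a → (∀ j → GS.Eigen A a (x j)) → GS.Independent x → EigenvaluesInAtLeast A I t
single-eigenvalue {t = t} A I a x Ia eigen independent =
  1 , (λ _ → a) , (λ _ → t)
    , (λ { zero zero 0≢0 _ → 0≢0 ≡.refl })
    , (λ _ → Ia)
    , (λ _ → x , (λ j → Eigen⇒InEigenspace A {a} {x j} (eigen j))
             , Independent⇒LinearlyIndependent x independent)
    , ℕ.+-identityʳ t

-- Complete multipartite graphs

open import Data.Nat.ListAction using (sum)

nonadjacent-pair⇒≇K : ∀ {m n} (G : Graph m) {u v} → u ≢ v → ¬ Adj G u v → ¬ (G ≅ K n)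
nonadjacent-pair⇒≇K G {u} {v} u≢v ¬adj (f , adj⇔) =
  ¬adj (Equivalence.from (adj⇔ u v) (u≢v ∘ Injection.injective (↔⇒↣ f)))

module _ (sizes : List ℕ) (nonempty : All (1 ℕ.≤_) sizes) where

  private
    representative : ∀ sizes → All (1 ℕ.≤_) sizes → ∀ i → ∃ λ u → partOf sizes u ≡ i
    representative (suc s ∷ ss) (_ ∷ ne) zero = zero , ≡.refl
    representative (s ∷ ss) (_ ∷ ne) (suc i) with representative ss ne i
    ... | u , pu≡i = s ↑ʳ u
      , ≡.trans (≡.cong [ const zero , suc ∘ partOf ss ]′ (Fin.splitAt-↑ʳ s _ u)) (≡.cong suc pu≡i)

  partOf-surjective : ∀ i → ∃ λ u → partOf sizes u ≡ i
  partOf-surjective = representative sizes nonempty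

  -- One representative from each part gives a clique, on which a proper colouring is injective.
  multipartite-chromaticNumber : IsChromaticNumber K⟨ sizes ⟩ (length sizes)
  multipartite-chromaticNumber = (partOf sizes , λ _ _ adj → adj) , λ k (c , proper) →
    Fin.injective⇒≤ {f = λ i → c (proj₁ (partOf-surjective i))} λ {i} {j} cᵢ≡cⱼ →
      decidable-stable (i Fin.≟ j) λ i≢j → proper _ _
        (λ pᵢ≡pⱼ → i≢j (≡.trans (≡.sym (proj₂ (partOf-surjective i)))
          (≡.trans pᵢ≡pⱼ (proj₂ (partOf-surjective j)))))
        cᵢ≡cⱼ

  -- The complement is a disjoint union of cliques, one on each part.
  multipartite-complement-components : ComponentCount (complement K⟨ sizes ⟩) (length sizes)
  multipartite-complement-components = partOf sizes , partOf-surjective , λ u v →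
    mk⇔ (join u v) λ (_ , p) → same-part p
    where
    join : ∀ u v → partOf sizes u ≡ partOf sizes v → Joined (complement K⟨ sizes ⟩) u v
    join u v pu≡pv with u Fin.≟ v
    ... | yes ≡.refl = 0 , []
    ... | no u≢v     = 1 , (u≢v , λ pu≢pv → pu≢pv pu≡pv) ∷ []

    same-part : ∀ {u v k} → Walk (complement K⟨ sizes ⟩) u v k → partOf sizes u ≡ partOf sizes v
    same-part [] = ≡.refl
    same-part {u} (_∷_ {v = w} (_ , ¬adj) p) =
      ≡.trans (decidable-stable (partOf sizes u Fin.≟ partOf sizes w) ¬adj) (same-part p)

  module _ (other : ∀ (i : Fin (length sizes)) → ∃ λ j → i ≢ j) where

    common-neighbour : ∀ u v → partOf sizes u ≡ partOf sizes v → Walk K⟨ sizes ⟩ u v 2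
    common-neighbour u v pu≡pv with other (partOf sizes u)
    ... | j , pu≢j with partOf-surjective j
    ...   | w , ≡.refl = pu≢j ∷ (λ pw≡pv → pu≢j (≡.trans pu≡pv (≡.sym pw≡pv))) ∷ []

    multipartite-connected : Connected K⟨ sizes ⟩
    multipartite-connected u v with partOf sizes u Fin.≟ partOf sizes v
    ... | yes pu≡pv = 2 , common-neighbour u v pu≡pv
    ... | no  pu≢pv = 1 , pu≢pv ∷ []

    module _ (conn : Connected K⟨ sizes ⟩) where

      multipartite-dist-same : ∀ u v → u ≢ v → partOf sizes u ≡ partOf sizes v →
                               dist K⟨ sizes ⟩ conn u v ≡ 2
      multipartite-dist-same u v u≢v pu≡pv = ℕ.≤-antisym
        (dist-≤ K⟨ sizes ⟩ conn (common-neighbour u v pu≡pv))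
        (dist-nonadjacent K⟨ sizes ⟩ conn u≢v λ pu≢pv → pu≢pv pu≡pv)

      multipartite-dist-across : ∀ u v → partOf sizes u ≢ partOf sizes v →
                                 dist K⟨ sizes ⟩ conn u v ≡ 1
      multipartite-dist-across u v pu≢pv =
        dist-adjacent K⟨ sizes ⟩ conn (pu≢pv ∘ ≡.cong (partOf sizes)) pu≢pv

other-element : ∀ {n} → 2 ℕ.≤ n → (i : Fin n) → ∃ λ j → i ≢ j
other-element (s≤s (s≤s _)) zero    = suc zero , λ ()
other-element (s≤s (s≤s _)) (suc i) = zero , λ ()

-- Exhibiting `k` eigenvalues suffices: that there are no more is the upper bound itself.
attains-bound : ∀ {n} (G : Graph n) (conn : Connected G) χ C k →
  ¬ (G ≅ K n) → IsChromaticNumber G χ → ComponentCount (complement G) C →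
  EigenvaluesInAtLeast (distanceLaplacian G conn) (window n χ) k →
  ⌈ n / χ ⌉ ℕ.+ C ℕ.+ k ≡ suc n → AttainsBound G χ
attains-bound {n} G conn χ C k G≇K chromatic components eigenvalues q+C+k≡1+n =
  G≇K , chromatic , conn , C , k , components
  , (eigenvalues , λ j eigenvalues′ → ℤ.drop‿+≤+ (≡.subst (+ j ℤ.≤_) bound≡k
      (upper-bound n G conn G≇K χ chromatic C components j eigenvalues′)))
  , ≡.sym bound≡k
  where
  bound≡k : bound n χ C ≡ + k
  bound≡k = ≡.trans
    (bound-decomposition n χ C {k} {0} (≡.trans (≡.cong (⌈ n / χ ⌉ ℕ.+ C ℕ.+_) (ℕ.+-identityʳ k)) q+C+k≡1+n))
    (≡.cong +_ (ℕ.+-identityʳ k))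

no-eigenvalues : ∀ {n} (A : Matrix n) I → EigenvaluesInAtLeast A I 0
no-eigenvalues A I = 0 , (λ ()) , (λ ()) , (λ ()) , (λ ()) , (λ ()) , ≡.refl

-- Equality for almost balanced complete bipartite graphs

module _ (m : ℕ) where

  private
    a t n : ℕ
    a = suc (suc m)
    -- The trailing 0 comes from `sum` on the list of parts and makes `n` definitionally equal to
    -- `sum parts`.
    t = m ℕ.+ 0
    n = a ℕ.+ suc t

    parts : List ℕ
    parts = a ∷ suc m ∷ []

    open BipartiteSpectrum Real.ℝ-orderedDomain a t
      using (side; difference; difference-eigen; difference-independent)

    nonempty : All (1 ℕ.≤_) parts
    nonempty = s≤s z≤n ∷ s≤s z≤n ∷ []

    other-part : ∀ (i : Fin 2) → ∃ λ j → i ≢ j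
    other-part = other-element (s≤s (s≤s z≤n))

    conn : Connected K⟨ parts ⟩
    conn = multipartite-connected parts nonempty other-part

    partOf-side : ∀ u → partOf parts u ≡ side (splitAt a u)
    partOf-side u = by-side (splitAt a u)
      where
      by-side : ∀ p → [ const zero , suc ∘ partOf (suc m ∷ []) ]′ p ≡ side p
      by-side (inj₁ _) = ≡.refl
      by-side (inj₂ v) with partOf (suc m ∷ []) v
      ... | zero = ≡.refl

    same-part : ∀ u v → side (splitAt a u) ≡ side (splitAt a v) → partOf parts u ≡ partOf parts v
    same-part u v eq = ≡.trans (partOf-side u) (≡.trans eq (≡.sym (partOf-side v)))

    different-part : ∀ u v → side (splitAt a u) ≢ side (splitAt a v) → partOf parts u ≢ partOf parts v
    different-part u v neq eq = neq (≡.trans (≡.sym (partOf-side u)) (≡.trans eq (partOf-side v)))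

    ⌈n/2⌉ : ⌈ n / 2 ⌉ ≡ a
    ⌈n/2⌉ = ≡.trans (≡.cong (ℕ._/ 2) (double m)) (ℕ.m*n/n≡m a 2)
      where
      double : ∀ m → suc (suc m) ℕ.+ suc (m ℕ.+ 0) ℕ.+ 1 ≡ suc (suc m) ℕ.* 2
      double = solve-∀

    eigenvector : ∀ j → GraphSpectrum.Eigen Real.ℝ-orderedDomain
      (distanceLaplacian K⟨ parts ⟩ conn) (fromℕ (n ℕ.+ suc t)) (difference j)
    eigenvector = difference-eigen K⟨ parts ⟩ conn
      (λ u v u≢v eq →
        multipartite-dist-same parts nonempty other-part conn u v u≢v (same-part u v eq))
      (λ u v neq →
        multipartite-dist-across parts nonempty other-part conn u v (different-part u v neq))
      (λ u v → ≡.refl)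

    -- The right end is n + a, with a = ⌈n/2⌉ the size of the larger side. Differences on that side
    -- have exactly this excluded eigenvalue, so those on the smaller side, one vertex short, are
    -- taken.
    in-window : window n 2 (fromℕ (n ℕ.+ suc t))
    in-window = Real.fromℕ-mono-< (ℕ.m<m+n n (s≤s z≤n))
              , Real.fromℕ-mono-< (ℕ.+-monoʳ-< n (≡.subst (suc t ℕ.<_) (≡.sym ⌈n/2⌉)
                  (s≤s (s≤s (ℕ.≤-reflexive (ℕ.+-identityʳ m))))))

  almost-balanced-bipartite-attains : AttainsBound K⟨ suc (suc m) ∷ suc m ∷ [] ⟩ 2
  almost-balanced-bipartite-attains = attains-bound K⟨ suc (suc m) ∷ suc m ∷ [] ⟩ conn 2 2 t
    (nonadjacent-pair⇒≇K K⟨ parts ⟩ {zero} {suc zero} (λ ()) λ adj → adj ≡.refl)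
    (multipartite-chromaticNumber parts nonempty)
    (multipartite-complement-components parts nonempty)
    (single-eigenvalue (distanceLaplacian K⟨ suc (suc m) ∷ suc m ∷ [] ⟩ conn)
      (window (sum (suc (suc m) ∷ suc m ∷ [])) 2)
      (fromℕ (n ℕ.+ suc t)) difference in-window eigenvector difference-independent)
    (≡.trans (≡.cong (λ q → q ℕ.+ 2 ℕ.+ t) ⌈n/2⌉) (total m))
    where
    total : ∀ m → suc (suc m) ℕ.+ 2 ℕ.+ (m ℕ.+ 0) ≡ suc (suc (suc m) ℕ.+ suc (m ℕ.+ 0))
    total = solve-∀

-- Equality for complete multipartite graphs with a single pair

sum-replicate-1 : ∀ n → sum (replicate n 1) ≡ n
sum-replicate-1 zero    = ≡.refl
sum-replicate-1 (suc n) = ≡.cong suc (sum-replicate-1 n)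

-- Here n = l + 2, χ = C = l + 1 and ⌈n/χ⌉ = 2, so the bound is 0 and no eigenvalue has to be
-- exhibited. `χ` is kept apart from `suc l` because `n ∸ 1` does not reduce to `suc (n ∸ 2)`.
one-pair-multipartite-attains : ∀ l {χ} → 1 ℕ.≤ l → suc l ≡ χ → AttainsBound K⟨ 2 ∷ replicate l 1 ⟩ χ
one-pair-multipartite-attains l {χ} 1≤l ≡.refl =
  attains-bound K⟨ 2 ∷ replicate l 1 ⟩ conn (suc l) (suc (length (replicate l 1))) 0
    (nonadjacent-pair⇒≇K K⟨ 2 ∷ replicate l 1 ⟩ {zero} {suc zero} (λ ()) λ adj → adj ≡.refl)
    (≡.subst (IsChromaticNumber K⟨ 2 ∷ replicate l 1 ⟩) (≡.cong suc (length-replicate l))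
      (multipartite-chromaticNumber (2 ∷ replicate l 1) nonempty))
    (multipartite-complement-components (2 ∷ replicate l 1) nonempty)
    (no-eigenvalues (distanceLaplacian K⟨ 2 ∷ replicate l 1 ⟩ conn)
      (window (sum (2 ∷ replicate l 1)) (suc l)))
    total
  where
  nonempty : All (1 ℕ.≤_) (2 ∷ replicate l 1)
  nonempty = s≤s z≤n ∷ All.replicate⁺ l (s≤s z≤n)

  conn : Connected K⟨ 2 ∷ replicate l 1 ⟩
  conn = multipartite-connected (2 ∷ replicate l 1) nonempty
    (other-element (s≤s (≡.subst (1 ℕ.≤_) (≡.sym (length-replicate l)) 1≤l)))

  ⌈n/χ⌉≡2 : ⌈ 2 ℕ.+ l / suc l ⌉ ≡ 2
  ⌈n/χ⌉≡2 = ≡.trans (≡.cong (ℕ._/ suc l) (double l)) (ℕ.m*n/n≡m 2 (suc l))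
    where
    double : ∀ l → 2 ℕ.+ l ℕ.+ l ≡ 2 ℕ.* suc l
    double = solve-∀

  total : ⌈ sum (2 ∷ replicate l 1) / suc l ⌉ ℕ.+ suc (length (replicate l 1)) ℕ.+ 0 ≡
          suc (sum (2 ∷ replicate l 1))
  total = ≡.trans (ℕ.+-identityʳ _) (≡.trans
    (≡.cong₂ (λ n k → ⌈ 2 ℕ.+ n / suc l ⌉ ℕ.+ suc k) (sum-replicate-1 l) (length-replicate l))
    (≡.trans (≡.cong (ℕ._+ suc l) ⌈n/χ⌉≡2) (≡.cong (3 ℕ.+_) (≡.sym (sum-replicate-1 l)))))

-- The bound together with its two equality cases

open import Data.Nat using (ℕ; suc; _∸_; _≤_; _+_; _*_)
open import Defs hiding (_+_; _*_; _<_; _≈_)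

theorem2p9 : (∀ n (G : Graph n) (conn : Connected G) → ¬ (G ≅ K n) →
    ∀ χ → IsChromaticNumber G χ →
    ∀ C → ComponentCount (complement G) C →
    ∀ k → EigenvaluesInAtLeast (distanceLaplacian G conn) (window n χ) k →
    + k ℤ.≤ bound n χ C)
    × (∀ m → 1 ≤ m →
    sum (suc m ∷ m ∷ []) ≡ 2 * m + 1
    × AttainsBound K⟨ suc m ∷ m ∷ [] ⟩ 2)
    × (∀ n → 3 ≤ n →
    sum (2 ∷ replicate (n ∸ 2) 1) ≡ n
    × AttainsBound K⟨ 2 ∷ replicate (n ∸ 2) 1 ⟩ (n ∸ 1))
theorem2p9 = upper-bound
  , (λ { (suc m) _ → bipartite-order (suc m) , almost-balanced-bipartite-attains m })
  , λ n 3≤n →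
      let 2≤n = ℕ.≤-trans (ℕ.n≤1+n 2) 3≤n in
      ≡.trans (≡.cong (λ k → 2 + k) (sum-replicate-1 (n ∸ 2))) (ℕ.m+[n∸m]≡n 2≤n)
    , one-pair-multipartite-attains (n ∸ 2) (ℕ.∸-monoˡ-≤ 2 3≤n) (≡.sym (ℕ.+-∸-assoc 1 2≤n))
  where
  bipartite-order : ∀ m → suc m + (m + 0) ≡ 2 * m + 1
  bipartite-order = solve-∀
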